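{- Let $K\subseteq L$ be a field extension of degree $2$ and let $A$ be a group of the form $L^\times/K^\times$. Then the rational rank of $A$ is either $0$ or infinite.
   Context: The rational rank of a commutative group $A$ is the cardinality of a maximal $\mathbb{Z}$-linearly independent subset of $A$; equivalently, it is $\dim_{\mathbb{Q}}(A\otimes_{\mathbb{Z}}\mathbb{Q})$. -}

module Defs where

open import Algebra.Bundles using (AbelianGroup; CommutativeRing)
import Algebra.Definitions
import Algebra.Definitions.RawMonoid as RawMonoidDefs
open import Algebra.Morphism.Structures using (IsGroupHomomorphism; IsRingHomomorphism)
import Algebra.Properties.AbelianGroup
import Algebra.Properties.CommutativeSemigroup
open import Data.Fin.Base using (Fin)
open import Data.Integer.Base using (ℤ; +_; -[1+_]; 0ℤ)
open import Data.Nat.Base using (ℕ; suc)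
open import Data.Product.Base using (Σ-syntax; ∃; ∃-syntax; _×_; _,_; proj₁; proj₂; swap)
open import Function.Bundles using (Bijection)
open import Function.Definitions using (Injective)
open import Level using (Level; _⊔_) renaming (suc to lsuc)
open import Relation.Binary.Bundles using (Setoid)
import Relation.Binary.Construct.On as On
open import Relation.Binary.Definitions using (_Respects_)
open import Relation.Binary.PropositionalEquality.Core using (_≡_)
import Relation.Binary.PropositionalEquality.Properties as ≡
import Relation.Binary.Reasoning.Setoid as SetoidReasoning
open import Relation.Nullary.Negation.Core using (¬_)
open import Relation.Unary using (Pred; _∈_; _⊆_)

private
  variable
    a b ℓ₁ ℓ₂ : Level

------------------------------------------------------------------------
-- Rational rank

module _ (A : AbelianGroup a ℓ₁) where
  open AbelianGroup A
  open RawMonoidDefs rawMonoid using (sum) renaming (_×_ to _×ℕ_)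

  infixr 8 _·_

  -- The ℤ-module structure; the group is written multiplicatively, so
  -- z · x is the z-th power of x and `sum` is an iterated product.
  _·_ : ℤ → Carrier → Carrier
  (+ n)    · x = n ×ℕ x
  -[1+ n ] · x = (suc n ×ℕ x) ⁻¹

  LinearlyIndependent : ∀ {p} → Pred Carrier p → Set (a ⊔ ℓ₁ ⊔ p)
  LinearlyIndependent S =
    ∀ n (x : Fin n → Carrier) → (∀ i → x i ∈ S) → Injective _≡_ _≈_ x →
    ∀ (z : Fin n → ℤ) → sum (λ i → z i · x i) ≈ ε → ∀ i → z i ≡ 0ℤ

  -- Subsets are predicates respecting _≈_.  The level a ⊔ ℓ₁ is enough
  -- for the sets generated from points of the group (such as S ∪ {x}).
  record IsMaximalIndependent (S : Pred Carrier (a ⊔ ℓ₁)) : Set (lsuc (a ⊔ ℓ₁)) where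
    field
      respects    : S Respects _≈_
      independent : LinearlyIndependent S
      maximal     : (T : Pred Carrier (a ⊔ ℓ₁)) → T Respects _≈_ →
                    LinearlyIndependent T → S ⊆ T → T ⊆ S

  subsetoid : ∀ {p} → Pred Carrier p → Setoid (a ⊔ p) ℓ₁
  subsetoid S = On.setoid {B = ∃ S} setoid proj₁

  HasRationalRank : ℕ → Set (lsuc (a ⊔ ℓ₁))
  HasRationalRank n =
    ∃[ S ] IsMaximalIndependent S × Bijection (≡.setoid (Fin n)) (subsetoid S)

  -- No maximal independent subset is finite.  Stated negatively because
  -- the existence of a maximal independent subset needs choice (Zorn).
  HasInfiniteRationalRank : Set (lsuc (a ⊔ ℓ₁))
  HasInfiniteRationalRank = ∀ n → ¬ HasRationalRank n

------------------------------------------------------------------------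
-- Fields and field extensions

module _ (R : CommutativeRing a ℓ₁) where
  open CommutativeRing R
  open Algebra.Definitions _≈_ using (Invertible)

  record IsField : Set (a ⊔ ℓ₁) where
    field
      1≉0        : ¬ 1# ≈ 0#
      invertible : ∀ x → ¬ x ≈ 0# → Invertible 1# _*_ x

module _ (K : CommutativeRing a ℓ₁) (L : CommutativeRing b ℓ₂) where
  private
    module K = CommutativeRing K
    module L = CommutativeRing L
  open RawMonoidDefs L.+-rawMonoid using (sum)

  -- L, regarded as a K-vector space along ι, has a basis of n elements.
  record HasDegree (ι : K.Carrier → L.Carrier) (n : ℕ) : Set (a ⊔ b ⊔ ℓ₁ ⊔ ℓ₂) where
    field
      basis       : Fin n → L.Carrier
      spanning    : ∀ x → Σ[ c ∈ (Fin n → K.Carrier) ]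
                          x L.≈ sum (λ i → ι (c i) L.* basis i)
      independent : ∀ (c : Fin n → K.Carrier) →
                    sum (λ i → ι (c i) L.* basis i) L.≈ L.0# → ∀ i → c i K.≈ K.0#

------------------------------------------------------------------------
-- The group of units of a commutative ring

module _ (R : CommutativeRing a ℓ₁) where
  open CommutativeRing R
  open Algebra.Definitions _≈_ using (Invertible)
  open Algebra.Properties.CommutativeSemigroup *-commutativeSemigroup using (interchange)

  private
    mul-inv : ∀ {x y x′ y′} → x′ * x ≈ 1# → y′ * y ≈ 1# → (x′ * y′) * (x * y) ≈ 1#
    mul-inv p q = trans (interchange _ _ _ _) (trans (*-cong p q) (*-identityˡ 1#))

  units : AbelianGroup (a ⊔ ℓ₁) ℓ₁
  units = record
    { Carrier = ∃ (Invertible 1# _*_)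
    ; _≈_     = λ u v → proj₁ u ≈ proj₁ v
    ; _∙_     = λ (x , x′ , p , q) (y , y′ , r , s) →
                  x * y , x′ * y′ , mul-inv p r , mul-inv q s
    ; ε       = 1# , 1# , *-identityˡ 1# , *-identityˡ 1#
    ; _⁻¹     = λ (x , x′ , inv) → x′ , x , swap inv
    ; isAbelianGroup = record
      { isGroup = record
        { isMonoid = record
          { isSemigroup = record
            { isMagma = record
              { isEquivalence = On.isEquivalence proj₁ isEquivalence
              ; ∙-cong        = *-cong
              }
            ; assoc = λ _ _ _ → *-assoc _ _ _
            }
          ; identity = (λ _ → *-identityˡ _) , (λ _ → *-identityʳ _)
          }
        ; inverse = (λ (_ , _ , p , _) → p) , (λ (_ , _ , _ , q) → q)
        ; ⁻¹-cong = λ {u} {v} → inv-cong u v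
        }
      ; comm = λ _ _ → *-comm _ _
      }
    }
    where
    inv-cong : (u v : ∃ (Invertible 1# _*_)) → proj₁ u ≈ proj₁ v →
               proj₁ (proj₂ u) ≈ proj₁ (proj₂ v)
    inv-cong (x , x′ , _ , q) (y , y′ , r , _) x≈y = begin
      x′             ≈⟨ *-identityˡ x′ ⟨
      1# * x′        ≈⟨ *-congʳ r ⟨
      (y′ * y) * x′  ≈⟨ *-assoc y′ y x′ ⟩
      y′ * (y * x′)  ≈⟨ *-congˡ (*-congʳ x≈y) ⟨
      y′ * (x * x′)  ≈⟨ *-congˡ q ⟩
      y′ * 1#        ≈⟨ *-identityʳ y′ ⟩
      y′             ∎
      where open SetoidReasoning setoid

module _ (K : CommutativeRing a ℓ₁) (L : CommutativeRing b ℓ₂) where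
  private
    module K = CommutativeRing K
    module L = CommutativeRing L
    module Kˣ = AbelianGroup (units K)
    module Lˣ = AbelianGroup (units L)

  module _ {ι : K.Carrier → L.Carrier}
           (ι-hom : IsRingHomomorphism K.rawRing L.rawRing ι) where
    open IsRingHomomorphism ι-hom

    units-map : Kˣ.Carrier → Lˣ.Carrier
    units-map (x , x′ , p , q) = ι x , ι x′ , preserve p , preserve q
      where
      preserve : ∀ {u v} → u K.* v K.≈ K.1# → ι u L.* ι v L.≈ L.1#
      preserve e = L.trans (L.sym (*-homo _ _)) (L.trans (⟦⟧-cong e) 1#-homo)

    units-map-isGroupHomomorphism :
      IsGroupHomomorphism Kˣ.rawGroup Lˣ.rawGroup units-map
    units-map-isGroupHomomorphism = record
      { isMonoidHomomorphism = record
        { isMagmaHomomorphism = record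
          { isRelHomomorphism = record { cong = ⟦⟧-cong }
          ; homo = λ _ _ → *-homo _ _
          }
        ; ε-homo = 1#-homo
        }
      ; ⁻¹-homo = λ _ → L.refl
      }

------------------------------------------------------------------------
-- The quotient of an abelian group by the image of a homomorphism

module _ (G : AbelianGroup a ℓ₁) (H : AbelianGroup b ℓ₂) where
  private
    module G = AbelianGroup G
    module H = AbelianGroup H

  module _ {f : G.Carrier → H.Carrier}
           (f-hom : IsGroupHomomorphism G.rawGroup H.rawGroup f) where
    open IsGroupHomomorphism f-hom
    open H
    open Algebra.Properties.AbelianGroup H using (⁻¹-∙-comm)
    open Algebra.Properties.CommutativeSemigroup commutativeSemigroup using (interchange)
    open SetoidReasoning setoid

    private
      infix 4 _∼_

      _∼_ : Carrier → Carrier → Set (a ⊔ ℓ₂)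
      x ∼ y = ∃[ g ] x ≈ f g ∙ y

      ≈⇒∼ : ∀ {x y} → x ≈ y → x ∼ y
      ≈⇒∼ {x} {y} x≈y = G.ε , (begin
        x          ≈⟨ x≈y ⟩
        y          ≈⟨ identityˡ y ⟨
        ε ∙ y      ≈⟨ ∙-congʳ ε-homo ⟨
        f G.ε ∙ y  ∎)

      ∼-sym : ∀ {x y} → x ∼ y → y ∼ x
      ∼-sym {x} {y} (g , e) = g G.⁻¹ , (begin
        y                    ≈⟨ identityˡ y ⟨
        ε ∙ y                ≈⟨ ∙-congʳ (inverseˡ (f g)) ⟨
        (f g ⁻¹ ∙ f g) ∙ y   ≈⟨ assoc _ _ _ ⟩
        f g ⁻¹ ∙ (f g ∙ y)   ≈⟨ ∙-cong (⁻¹-homo g) e ⟨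
        f (g G.⁻¹) ∙ x       ∎)

      ∼-trans : ∀ {x y z} → x ∼ y → y ∼ z → x ∼ z
      ∼-trans {x} {y} {z} (g , e) (h , d) = g G.∙ h , (begin
        x                ≈⟨ e ⟩
        f g ∙ y          ≈⟨ ∙-congˡ d ⟩
        f g ∙ (f h ∙ z)  ≈⟨ assoc _ _ _ ⟨
        (f g ∙ f h) ∙ z  ≈⟨ ∙-congʳ (homo g h) ⟨
        f (g G.∙ h) ∙ z  ∎)

      ∼-∙-cong : ∀ {x y u v} → x ∼ y → u ∼ v → x ∙ u ∼ y ∙ v
      ∼-∙-cong {x} {y} {u} {v} (g , e) (h , d) = g G.∙ h , (begin
        x ∙ u                    ≈⟨ ∙-cong e d ⟩
        (f g ∙ y) ∙ (f h ∙ v)    ≈⟨ interchange _ _ _ _ ⟩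
        (f g ∙ f h) ∙ (y ∙ v)    ≈⟨ ∙-congʳ (homo g h) ⟨
        f (g G.∙ h) ∙ (y ∙ v)    ∎)

      ∼-⁻¹-cong : ∀ {x y} → x ∼ y → x ⁻¹ ∼ y ⁻¹
      ∼-⁻¹-cong {x} {y} (g , e) = g G.⁻¹ , (begin
        x ⁻¹                ≈⟨ ⁻¹-cong e ⟩
        (f g ∙ y) ⁻¹        ≈⟨ ⁻¹-∙-comm (f g) y ⟨
        f g ⁻¹ ∙ y ⁻¹       ≈⟨ ∙-congʳ (⁻¹-homo g) ⟨
        f (g G.⁻¹) ∙ y ⁻¹   ∎)

    cokernel : AbelianGroup b (a ⊔ ℓ₂)
    cokernel = record
      { Carrier = Carrier
      ; _≈_     = _∼_
      ; _∙_     = _∙_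
      ; ε       = ε
      ; _⁻¹     = _⁻¹
      ; isAbelianGroup = record
        { isGroup = record
          { isMonoid = record
            { isSemigroup = record
              { isMagma = record
                { isEquivalence = record
                  { refl = ≈⇒∼ refl ; sym = ∼-sym ; trans = ∼-trans }
                ; ∙-cong = ∼-∙-cong
                }
              ; assoc = λ x y z → ≈⇒∼ (assoc x y z)
              }
            ; identity = (λ x → ≈⇒∼ (identityˡ x)) , (λ x → ≈⇒∼ (identityʳ x))
            }
          ; inverse = (λ x → ≈⇒∼ (inverseˡ x)) , (λ x → ≈⇒∼ (inverseʳ x))
          ; ⁻¹-cong = ∼-⁻¹-cong
          }
        ; comm = λ x y → ≈⇒∼ (comm x y)
        }
      }

-- Lˣ / Kˣ, where K is embedded in L by ι.
unitsQuotient : (K : CommutativeRing a ℓ₁) (L : CommutativeRing b ℓ₂) →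
  let module K = CommutativeRing K ; module L = CommutativeRing L in
  {ι : K.Carrier → L.Carrier} → IsRingHomomorphism K.rawRing L.rawRing ι →
  AbelianGroup (b ⊔ ℓ₂) (a ⊔ ℓ₁ ⊔ ℓ₂)
unitsQuotient K L ι-hom =
  cokernel (units K) (units L) (units-map-isGroupHomomorphism K L ι-hom)

{-# OPTIONS --safe #-}

-- If some element of Lˣ is not torsion modulo Kˣ, then L = K(β) with β² = β + d, and β is not
-- torsion either.  Suppose Lˣ/Kˣ had finite rank and let conj be the conjugation of L over K.
-- Adjoin to ℤ[d] the inverse of 1 + 4d and the coordinates of x / conj x for the finitely many x
-- in a maximal independent set, and call the resulting subring of K R.  The y ∈ Lˣ having a
-- power of y / conj y in R[β] form a saturated subgroup, which is therefore all of Lˣ.  For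
-- y = n + β with n ∈ ℤ[d] this makes the norm n² + n − d a unit of R, hence a divisor of a power
-- of some fixed nonzero h ∈ ℤ[d].  That is impossible
-- * if d is transcendental over the prime ring, by comparing degrees in d;
-- * if d is algebraic and the characteristic is 0, because then infinitely many values
--   p(n² + n) of the minimal polynomial p of d would be associates of p(0) in ℤ;
-- * if d is algebraic and the characteristic is positive, because then β is torsion modulo Kˣ.
module Submission where

open import Defs
open import Algebra.Bundles using (AbelianGroup; CommutativeRing)
import Algebra.Definitions.RawMonoid
open import Algebra.Morphism.Structures using (IsRingHomomorphism)
import Algebra.Properties.CommutativeMonoid.Sum
import Algebra.Properties.CommutativeSemiring.Exp
import Algebra.Properties.Group
import Algebra.Properties.Ring
import Algebra.Properties.Semiring.Exp
import Algebra.Properties.Semiring.Mult.TCOptimised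
import Algebra.Solver.Ring
open import Algebra.Solver.Ring.AlmostCommutativeRing
  using (fromCommutativeRing; _-Raw-AlmostCommutative⟶_)
open import Axiom.ExcludedMiddle using (ExcludedMiddle)
open import Data.Empty using (⊥; ⊥-elim)
open import Data.Fin.Base as Fin using (Fin; toℕ; fromℕ<; combine; punchIn; punchOut)
import Data.Fin.Properties as Fin
open import Data.Integer.Base as ℤ using (ℤ; +_; -[1+_]; _⊖_; ∣_∣; 0ℤ)
import Data.Integer.DivMod as ℤ
import Data.Integer.Properties as ℤ
open import Data.List.Base using (List; []; _∷_; _++_; tabulate)
open import Data.List.Membership.Propositional using () renaming (_∈_ to _∈ˡ_)
open import Data.List.Membership.Propositional.Properties using (∈-++⁺ˡ; ∈-++⁺ʳ; ∈-tabulate⁺)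
open import Data.List.Relation.Unary.Any using (here; there)
open import Data.Maybe.Base using (map)
open import Data.Nat.Base as ℕ using (ℕ; zero; suc; _≤_; _<_; z≤n; s≤s; _≤′_; ≤′-refl; ≤′-step)
open import Data.Nat.Induction using (<-rec)
import Data.Nat.Properties as ℕ
open import Data.Product.Base using (_×_; _,_; proj₁; proj₂; ∃-syntax; Σ-syntax)
open import Data.Sum.Base using (_⊎_; inj₁; inj₂; [_,_]′)
open import Function.Base using (_∘_)
open import Function.Bundles using (Bijection)
open import Level using (Level; Lift; lower; _⊔_)
open import Relation.Binary.Definitions using (_Respects_; tri<; tri≈; tri>)
open import Relation.Binary.PropositionalEquality.Core as ≡ using (_≡_)
import Relation.Binary.Reasoning.Setoid
open import Relation.Nullary using (¬_; yes; no)
open import Relation.Nullary.Decidable using (decidable-stable; dec⇒maybe)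
open import Relation.Unary using (Pred; _∈_; _⊆_)

-- The ratio y / conj y does not change when y is multiplied by an element of K, so it depends only
-- on the class of y modulo Kˣ; allowing powers of it is what makes the subgroup saturated. The
-- number 1 + 4d is the square of β - conj β. Once it is invertible, n + β and its conjugate are
-- comaximal in R[β], so a power of their ratio can be integral only if the conjugate is a unit. The
-- obstacle is that R may contain elements of K unrelated to d. They are removed one at a time: a
-- generator algebraic over the ring below it is eliminated through its minimal polynomial, a
-- transcendental one by comparing leading coefficients. Either way units of R turn into divisors of
-- powers of one fixed element of the smaller ring, which leaves a question about n² + n - d in ℤ[d]
-- alone. A β of trace 1 exists because an irrational element of trace zero has its square in K and
-- is therefore torsion; in particular L is separable over K, also in characteristic 2. In positive
-- characteristic with d algebraic, β lies in a finite field, hence is a root of unity.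

private
  variable
    c ℓ p : Level

-- Integers in a commutative ring and the ring solver

module IntegerCoefficients (R : CommutativeRing c ℓ) where
  open CommutativeRing R
  open Algebra.Properties.Ring ring
  open Algebra.Properties.Semiring.Mult.TCOptimised semiring
    renaming (_×_ to _×ℕ_) using (1+×; ×-homo-+; ×1-homo-*)
  open Relation.Binary.Reasoning.Setoid setoid

  -- With the optimised multiple, `fromℕ 1` reduces to `1#`, so `con (+ 1)` in a solver equation
  -- denotes `1#` itself.
  fromℕ : ℕ → Carrier
  fromℕ n = n ×ℕ 1#

  fromℤ : ℤ → Carrier
  fromℤ (+ n)    = fromℕ n
  fromℤ -[1+ n ] = - fromℕ (suc n)

  private
    cancel-1 : ∀ x y → (1# + x) - (1# + y) ≈ x - y
    cancel-1 x y = begin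
      (1# + x) - (1# + y)      ≈⟨ +-cong (+-comm 1# x) (sym (-‿+-comm 1# y)) ⟩
      (x + 1#) + (- 1# - y)    ≈⟨ +-assoc x 1# _ ⟩
      x + (1# + (- 1# - y))    ≈⟨ +-congˡ (+-assoc 1# (- 1#) _) ⟨
      x + ((1# - 1#) - y)      ≈⟨ +-congˡ (+-congʳ (-‿inverseʳ 1#)) ⟩
      x + (0# - y)             ≈⟨ +-congˡ (+-identityˡ _) ⟩
      x - y                    ∎

    fromℤ-⊖ : ∀ m n → fromℤ (m ⊖ n) ≈ fromℕ m - fromℕ n
    fromℤ-⊖ m       zero    = trans (sym (+-identityʳ _)) (+-congˡ (sym -0#≈0#))
    fromℤ-⊖ zero    (suc n) = sym (+-identityˡ _)
    fromℤ-⊖ (suc m) (suc n) = begin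
      fromℤ (suc m ⊖ suc n)            ≡⟨ ≡.cong fromℤ (ℤ.[1+m]⊖[1+n]≡m⊖n m n) ⟩
      fromℤ (m ⊖ n)                    ≈⟨ fromℤ-⊖ m n ⟩
      fromℕ m - fromℕ n                ≈⟨ cancel-1 _ _ ⟨
      (1# + fromℕ m) - (1# + fromℕ n)  ≈⟨ +-cong (1+× m 1#) (-‿cong (1+× n 1#)) ⟨
      fromℕ (suc m) - fromℕ (suc n)    ∎

  fromℤ-neg : ∀ i → fromℤ (ℤ.- i) ≈ - fromℤ i
  fromℤ-neg (+ zero)  = sym -0#≈0#
  fromℤ-neg (+ suc n) = refl
  fromℤ-neg -[1+ n ]  = sym (-‿involutive _)

  fromℤ-+ : ∀ i j → fromℤ (i ℤ.+ j) ≈ fromℤ i + fromℤ j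
  fromℤ-+ (+ m)    (+ n)    = ×-homo-+ 1# m n
  fromℤ-+ (+ m)    -[1+ n ] = fromℤ-⊖ m (suc n)
  fromℤ-+ -[1+ m ] (+ n)    = trans (fromℤ-⊖ n (suc m)) (+-comm _ _)
  fromℤ-+ -[1+ m ] -[1+ n ] = begin
    - fromℕ (suc (suc (m ℕ.+ n)))    ≡⟨ ≡.cong (λ k → - fromℕ (suc k)) (≡.sym (ℕ.+-suc m n)) ⟩
    - fromℕ (suc m ℕ.+ suc n)        ≈⟨ -‿cong (×-homo-+ 1# (suc m) (suc n)) ⟩
    - (fromℕ (suc m) + fromℕ (suc n)) ≈⟨ -‿+-comm _ _ ⟨
    - fromℕ (suc m) - fromℕ (suc n)  ∎
    where import Data.Nat.Properties as ℕ

  private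
    fromℤ-*ʳ : ∀ m j → fromℤ (+ m ℤ.* j) ≈ fromℕ m * fromℤ j
    fromℤ-*ʳ m (+ n) = trans (reflexive (≡.cong fromℤ (≡.sym (ℤ.pos-* m n)))) (×1-homo-* m n)
    fromℤ-*ʳ m -[1+ n ] = begin
      fromℤ (+ m ℤ.* -[1+ n ])       ≡⟨ ≡.cong fromℤ (ℤ.neg-distribʳ-* (+ m) (+ suc n)) ⟨
      fromℤ (ℤ.- (+ m ℤ.* + suc n))  ≈⟨ fromℤ-neg (+ m ℤ.* + suc n) ⟩
      - fromℤ (+ m ℤ.* + suc n)      ≈⟨ -‿cong (fromℤ-*ʳ m (+ suc n)) ⟩
      - (fromℕ m * fromℕ (suc n))    ≈⟨ -‿distribʳ-* _ _ ⟩
      fromℕ m * - fromℕ (suc n)      ∎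

  fromℤ-* : ∀ i j → fromℤ (i ℤ.* j) ≈ fromℤ i * fromℤ j
  fromℤ-* (+ m)    j = fromℤ-*ʳ m j
  fromℤ-* -[1+ m ] j = begin
    fromℤ (-[1+ m ] ℤ.* j)         ≡⟨ ≡.cong fromℤ (ℤ.neg-distribˡ-* (+ suc m) j) ⟨
    fromℤ (ℤ.- (+ suc m ℤ.* j))    ≈⟨ fromℤ-neg (+ suc m ℤ.* j) ⟩
    - fromℤ (+ suc m ℤ.* j)        ≈⟨ -‿cong (fromℤ-*ʳ (suc m) j) ⟩
    - (fromℕ (suc m) * fromℤ j)    ≈⟨ -‿distribˡ-* _ _ ⟩
    - fromℕ (suc m) * fromℤ j      ∎

  fromℤ-morphism : ℤ.+-*-rawRing -Raw-AlmostCommutative⟶ fromCommutativeRing R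
  fromℤ-morphism = record
    { ⟦_⟧    = fromℤ
    ; +-homo = fromℤ-+
    ; *-homo = fromℤ-*
    ; -‿homo = fromℤ-neg
    ; 0-homo = refl
    ; 1-homo = refl
    }

  module Solver = Algebra.Solver.Ring ℤ.+-*-rawRing (fromCommutativeRing R) fromℤ-morphism
    (λ i j → map (λ i≡j → reflexive (≡.cong fromℤ i≡j)) (dec⇒maybe (i ℤ.≟ j)))

-- Subrings and divisibility within them

module Subrings (R : CommutativeRing c ℓ) where
  open CommutativeRing R
  open Algebra.Properties.Semiring.Exp semiring using (_^_; ^-homo-*)
  open Algebra.Properties.CommutativeSemiring.Exp commutativeSemiring using (^-distrib-*)
  open IntegerCoefficients R
  open Solver using (solve; _:=_; con; _:+_; _:*_; _:-_; :-_)
  open Relation.Binary.Reasoning.Setoid setoid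

  record IsSubring (P : Pred Carrier p) : Set (c ⊔ ℓ ⊔ p) where
    field
      respects : P Respects _≈_
      0∈       : P 0#
      1∈       : P 1#
      +-closed : ∀ {x y} → P x → P y → P (x + y)
      *-closed : ∀ {x y} → P x → P y → P (x * y)
      neg-closed : ∀ {x} → P x → P (- x)

    ^-closed : ∀ {x} n → P x → P (x ^ n)
    ^-closed zero    Px = 1∈
    ^-closed (suc n) Px = *-closed Px (^-closed n Px)

  -- In a field every nonzero element divides everything; the content lies in where the quotient is
  -- found.
  record _∣_within_ (x y : Carrier) (P : Pred Carrier p) : Set (c ⊔ ℓ ⊔ p) where
    constructor divides
    field
      {quotient} : Carrier
      quotient∈  : P quotient
      equation   : x * quotient ≈ y

  -- Modulo 1 + h q the power hᴹ is 0 and −h q is 1.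
  coprime-divisor : {P : Pred Carrier p} → IsSubring P → ∀ {h q} → P h → P q →
                    ∀ M → (1# + h * q) ∣ h ^ M within P → (1# + h * q) ∣ 1# within P
  coprime-divisor         sub         h∈ q∈ zero    d = d
  coprime-divisor {P = P} sub {h} {q} h∈ q∈ (suc M) (divides {a} a∈ eq) =
    coprime-divisor sub h∈ q∈ M (divides (+-closed (^-closed M h∈) (neg-closed (*-closed a∈ q∈))) (begin
      (1# + h * q) * (h ^ M - a * q)
        ≈⟨ solve 4 (λ h q r a → (con (+ 1) :+ h :* q) :* (r :- a :* q) :=
                      r :+ q :* (h :* r :- (con (+ 1) :+ h :* q) :* a)) refl h q (h ^ M) a ⟩
      h ^ M + q * (h * h ^ M - (1# + h * q) * a)
        ≈⟨ +-congˡ (*-congˡ (+-congˡ (-‿cong eq))) ⟩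
      h ^ M + q * (h * h ^ M - h * h ^ M)
        ≈⟨ solve 3 (λ h q r → r :+ q :* (h :* r :- h :* r) := r) refl h q (h ^ M) ⟩
      h ^ M ∎))
    where open IsSubring sub

  1^n≈1 : ∀ n → 1# ^ n ≈ 1#
  1^n≈1 zero    = refl
  1^n≈1 (suc n) = trans (*-identityˡ _) (1^n≈1 n)

  ∣-trans : {P : Pred Carrier p} → IsSubring P → ∀ {x y z} → x ∣ y within P → y ∣ z within P → x ∣ z within P
  ∣-trans sub (divides q∈ xq≈y) (divides r∈ yr≈z) = divides (IsSubring.*-closed sub q∈ r∈)
    (trans (sym (*-assoc _ _ _)) (trans (*-congʳ xq≈y) yr≈z))

  ≈⇒∣ : {P : Pred Carrier p} → IsSubring P → ∀ {x y} → x ≈ y → x ∣ y within P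
  ≈⇒∣ sub x≈y = divides (IsSubring.1∈ sub) (trans (*-identityʳ _) x≈y)

  -- Merges powers of two fixed elements, with unrelated exponents, into a power of the single fixed
  -- element `x * y`.
  ^*^-∣-^ : {P : Pred Carrier p} → IsSubring P → ∀ {x y} → P x → P y → ∀ m n →
            (x ^ m * y ^ n) ∣ (x * y) ^ (m ℕ.+ n) within P
  ^*^-∣-^ sub {x} {y} x∈ y∈ m n = divides (*-closed (^-closed n x∈) (^-closed m y∈)) (begin
    (x ^ m * y ^ n) * (x ^ n * y ^ m)
      ≈⟨ solve 4 (λ a b c d → (a :* b) :* (c :* d) := (a :* c) :* (d :* b)) refl (x ^ m) (y ^ n) (x ^ n) (y ^ m) ⟩
    (x ^ m * x ^ n) * (y ^ m * y ^ n)
      ≈⟨ *-cong (^-homo-* x m n) (^-homo-* y m n) ⟨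
    x ^ (m ℕ.+ n) * y ^ (m ℕ.+ n)
      ≈⟨ ^-distrib-* x y (m ℕ.+ n) ⟨
    (x * y) ^ (m ℕ.+ n) ∎)
    where open IsSubring sub

-- Polynomials over a subring and pseudo-division

-- Polynomials are represented by the functions they define, so that an identity
-- between polynomials is one between values at all points of the ring.
module Polynomials (R : CommutativeRing c ℓ) {P : Pred (CommutativeRing.Carrier R) p}
                   (sub : Subrings.IsSubring R P) where
  open CommutativeRing R
  open Algebra.Properties.Semiring.Exp semiring using (_^_; ^-homo-*)
  open IntegerCoefficients R
  open Solver using (solve; _:=_; con; _:+_; _:*_; _:-_; :-_)
  open Subrings R
  open IsSubring sub
  open Relation.Binary.Reasoning.Setoid setoid

  private
    variable
      m n : ℕ
      a b : Carrier
      f g h : Carrier → Carrier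

  mutual
    -- Degree less than n, coefficients in P.
    data Poly : ℕ → (Carrier → Carrier) → Set (c ⊔ ℓ ⊔ p) where
      vanishing : (∀ x → f x ≈ 0#) → Poly 0 f
      leading   : Leading n a f → Poly (suc n) f

    -- The coefficient a of xⁿ is allowed to vanish.
    record Leading (n : ℕ) (a : Carrier) (f : Carrier → Carrier) : Set (c ⊔ ℓ ⊔ p) where
      inductive
      constructor leading-term
      field
        {lower}    : Carrier → Carrier
        lower-poly : Poly n lower
        lead∈      : P a
        expansion  : ∀ x → f x ≈ lower x + a * x ^ n

  Leading-resp : (∀ x → f x ≈ g x) → Leading n a f → Leading n a g
  Leading-resp f≈g (leading-term l a∈ eq) = leading-term l a∈ (λ x → trans (sym (f≈g x)) (eq x))

  Poly-resp : (∀ x → f x ≈ g x) → Poly n f → Poly n g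
  Poly-resp f≈g (vanishing f≈0) = vanishing (λ x → trans (sym (f≈g x)) (f≈0 x))
  Poly-resp f≈g (leading l)     = leading (Leading-resp f≈g l)

  Poly-suc : Poly n f → Poly (suc n) f
  Poly-suc {n} {f} pf = leading (leading-term pf 0∈
    (λ x → solve 2 (λ u v → u := u :+ con (+ 0) :* v) refl (f x) (x ^ n)))

  Poly-0 : ∀ n → Poly n (λ _ → 0#)
  Poly-0 zero    = vanishing (λ _ → refl)
  Poly-0 (suc n) = Poly-suc (Poly-0 n)

  Poly-cast : m ≡ n → Poly m f → Poly n f
  Poly-cast ≡.refl pf = pf

  Poly-≤′ : m ≤′ n → Poly m f → Poly n f
  Poly-≤′ ≤′-refl       pf = pf
  Poly-≤′ (≤′-step m≤n) pf = Poly-suc (Poly-≤′ m≤n pf)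

  Poly-≤ : m ≤ n → Poly m f → Poly n f
  Poly-≤ m≤n = Poly-≤′ (ℕ.≤⇒≤′ m≤n)

  mutual
    Poly-+ : Poly n f → Poly n g → Poly n (λ x → f x + g x)
    Poly-+ (vanishing f≈0) (vanishing g≈0) =
      vanishing (λ x → trans (+-cong (f≈0 x) (g≈0 x)) (+-identityˡ 0#))
    Poly-+ (leading lf) (leading lg) = leading (Leading-+-Leading lf lg)

    Leading-+-Leading : Leading n a f → Leading n b g → Leading n (a + b) (λ x → f x + g x)
    Leading-+-Leading {n} {a} {f} {b} {g} (leading-term {f₀} pf a∈ eqf) (leading-term {g₀} pg b∈ eqg) =
      leading-term (Poly-+ pf pg) (+-closed a∈ b∈) λ x → begin
        f x + g x                                  ≈⟨ +-cong (eqf x) (eqg x) ⟩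
        (f₀ x + a * x ^ n) + (g₀ x + b * x ^ n)
          ≈⟨ solve 5 (λ u a v b w → (u :+ a :* w) :+ (v :+ b :* w) := (u :+ v) :+ (a :+ b) :* w)
               refl (f₀ x) a (g₀ x) b (x ^ n) ⟩
        (f₀ x + g₀ x) + (a + b) * x ^ n            ∎

  Leading-+ : Leading n a f → Poly n g → Leading n a (λ x → f x + g x)
  Leading-+ {n} {a} {f} {g} (leading-term {f₀} pf a∈ eqf) pg =
    leading-term (Poly-+ pf pg) a∈ λ x → begin
      f x + g x                   ≈⟨ +-congʳ (eqf x) ⟩
      (f₀ x + a * x ^ n) + g x
        ≈⟨ solve 4 (λ u a v w → (u :+ a :* w) :+ v := (u :+ v) :+ a :* w)
             refl (f₀ x) a (g x) (x ^ n) ⟩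
      (f₀ x + g x) + a * x ^ n    ∎

  mutual
    Poly-scale : P b → Poly n f → Poly n (λ x → b * f x)
    Poly-scale {b} b∈ (vanishing f≈0) = vanishing (λ x → trans (*-congˡ (f≈0 x)) (zeroʳ b))
    Poly-scale     b∈ (leading lf)    = leading (Leading-scale b∈ lf)

    Leading-scale : P b → Leading n a f → Leading n (b * a) (λ x → b * f x)
    Leading-scale {b} {n} {a} b∈ (leading-term {f₀} pf a∈ eq) =
      leading-term (Poly-scale b∈ pf) (*-closed b∈ a∈) λ x → trans (*-congˡ (eq x))
        (solve 4 (λ b u a w → b :* (u :+ a :* w) := b :* u :+ (b :* a) :* w) refl b (f₀ x) a (x ^ n))

  Poly-neg : Poly n f → Poly n (λ x → - f x)
  Poly-neg {f = f} pf = Poly-resp (λ x → solve 1 (λ u → con (ℤ.- (+ 1)) :* u := :- u) refl (f x))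
                          (Poly-scale (neg-closed 1∈) pf)

  Poly-const : P a → Poly 1 (λ _ → a)
  Poly-const {a} a∈ = leading (leading-term (Poly-0 0) a∈
    (λ x → solve 1 (λ a → a := con (+ 0) :+ a :* con (+ 1)) refl a))

  Poly-shift : Poly n f → Poly (suc n) (λ x → x * f x)
  Poly-shift (vanishing f≈0) =
    Poly-resp (λ x → sym (trans (*-congˡ (f≈0 x)) (zeroʳ x))) (Poly-0 1)
  Poly-shift (leading {n} {a} (leading-term {f₀} pf a∈ eq)) =
    leading (leading-term (Poly-shift pf) a∈ λ x → trans (*-congˡ (eq x))
      (solve 4 (λ x u a w → x :* (u :+ a :* w) := x :* u :+ a :* (x :* w)) refl x (f₀ x) a (x ^ n)))

  Poly-shift^ : ∀ m → Poly n f → Poly (m ℕ.+ n) (λ x → x ^ m * f x)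
  Poly-shift^ zero    pf = Poly-resp (λ x → sym (*-identityˡ _)) pf
  Poly-shift^ (suc m) pf = Poly-resp (λ x → sym (*-assoc _ _ _)) (Poly-shift (Poly-shift^ m pf))

  Poly-* : Poly m f → Poly n g → Poly (m ℕ.+ n) (λ x → f x * g x)
  Poly-* {n = n} (vanishing f≈0) pg =
    Poly-resp (λ x → sym (trans (*-congʳ (f≈0 x)) (zeroˡ _))) (Poly-0 n)
  Poly-* {g = g} (leading {m} {a} (leading-term {f₀} pf a∈ eq)) pg =
    Poly-resp (λ x → trans
      (solve 4 (λ u a v w → u :* v :+ w :* (a :* v) := (u :+ a :* w) :* v) refl (f₀ x) a (g x) (x ^ m))
      (*-congʳ (sym (eq x))))
      (Poly-suc (Poly-+ (Poly-* pf pg) (Poly-shift^ m (Poly-scale a∈ pg))))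

  Leading-* : Leading m a f → Leading n b g → Leading (m ℕ.+ n) (a * b) (λ x → f x * g x)
  Leading-* {m} {a} {f} {n} {b} {g} (leading-term {f₀} pf a∈ eqf) (leading-term {g₀} pg b∈ eqg) =
    leading-term
      (Poly-+ (Poly-+ (Poly-* pf pg)
                      (Poly-cast (ℕ.+-comm n m) (Poly-shift^ n (Poly-scale b∈ pf))))
              (Poly-shift^ m (Poly-scale a∈ pg)))
      (*-closed a∈ b∈)
      λ x → begin
        f x * g x                                    ≈⟨ *-cong (eqf x) (eqg x) ⟩
        (f₀ x + a * x ^ m) * (g₀ x + b * x ^ n)
          ≈⟨ solve 6 (λ u a s v b t → (u :+ a :* s) :* (v :+ b :* t) :=
                        (u :* v :+ t :* (b :* u) :+ s :* (a :* v)) :+ (a :* b) :* (s :* t))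
               refl (f₀ x) a (x ^ m) (g₀ x) b (x ^ n) ⟩
        (f₀ x * g₀ x + x ^ n * (b * f₀ x) + x ^ m * (a * g₀ x)) + (a * b) * (x ^ m * x ^ n)
          ≈⟨ +-congˡ (*-congˡ (^-homo-* x m n)) ⟨
        (f₀ x * g₀ x + x ^ n * (b * f₀ x) + x ^ m * (a * g₀ x)) + (a * b) * x ^ (m ℕ.+ n) ∎

  Leading-const : P a → Leading 0 a (λ _ → a)
  Leading-const {a} a∈ = leading-term (Poly-0 0) a∈
    (λ x → solve 1 (λ a → a := con (+ 0) :+ a :* con (+ 1)) refl a)

  Leading-id : Leading 1 1# (λ x → x)
  Leading-id = leading-term (Poly-0 1) 1∈
    (λ x → solve 1 (λ x → x := con (+ 0) :+ con (+ 1) :* (x :* con (+ 1))) refl x)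

  Leading-monomial : ∀ n → P a → Leading n a (λ x → a * x ^ n)
  Leading-monomial n a∈ = leading-term (Poly-0 n) a∈ (λ x → sym (+-identityˡ _))

  Leading-^ : Leading n a f → ∀ k → Leading (k ℕ.* n) (a ^ k) (λ x → f x ^ k)
  Leading-^ l zero    = Leading-const 1∈
  Leading-^ l (suc k) = Leading-* l (Leading-^ l k)

  Poly-closed : Poly n f → ∀ {x} → P x → P (f x)
  Poly-closed (vanishing f≈0) _ = respects (sym (f≈0 _)) 0∈
  Poly-closed (leading {n} (leading-term pf a∈ eq)) x∈ =
    respects (sym (eq _)) (+-closed (Poly-closed pf x∈) (*-closed a∈ (^-closed n x∈)))

  -- `Quotient` is a parameter because some uses want a degree bound for the quotient and others its
  -- leading coefficient.
  record PseudoDivision (Quotient : (Carrier → Carrier) → Set (c ⊔ ℓ ⊔ p)) (m k : ℕ) (e : Carrier)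
                        (f g : Carrier → Carrier) : Set (c ⊔ ℓ ⊔ p) where
    constructor pseudo-division
    field
      {quotient remainder} : Carrier → Carrier
      quotient-poly  : Quotient quotient
      remainder-poly : Poly m remainder
      equation       : ∀ x → e ^ k * g x ≈ f x * quotient x + remainder x

  mutual
    -- The leading coefficient `b` of the divisor need not be invertible in `P`, so each step
    -- multiplies the dividend by `b` instead; `i` steps cost the factor `b ^ i`.
    pseudo-divide : ∀ i → Leading m b f → Poly (i ℕ.+ m) g →
                    PseudoDivision (Poly i) m i b f g
    pseudo-divide {f = f} {g} zero lf pg = pseudo-division (Poly-0 0) pg
      (λ x → solve 2 (λ u v → con (+ 1) :* v := u :* con (+ 0) :+ v) refl (f x) (g x))
    pseudo-divide (suc i) lf (leading lg) with pseudo-divide-leading i lf lg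
    ... | pseudo-division lq pr eq = pseudo-division (leading lq) pr eq

    pseudo-divide-leading : ∀ i → Leading m b f → Leading (i ℕ.+ m) a g →
                            PseudoDivision (Leading i (b ^ i * a)) m (suc i) b f g
    pseudo-divide-leading {m} {b} {f} {a} {g} i lf@(leading-term {f₀} pf b∈ eqf)
                          lg@(leading-term {g₀} pg a∈ eqg)
      -- This is `b g - a xⁱ f` after its leading terms have cancelled.
      with pseudo-divide i lf (Poly-+ (Poly-scale b∈ pg)
                                      (Poly-neg (Poly-shift^ i (Poly-scale a∈ pf))))
    ... | pseudo-division {q} {r} pq pr eq =
      pseudo-division
        (Leading-resp (λ x → +-comm _ _)
          (Leading-+ (Leading-monomial i (*-closed (^-closed i b∈) a∈)) pq))
        pr
        λ x → begin
          (b * b ^ i) * g x                                    ≈⟨ *-congˡ (eqg x) ⟩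
          (b * b ^ i) * (g₀ x + a * x ^ (i ℕ.+ m))             ≈⟨ *-congˡ (+-congˡ (*-congˡ (^-homo-* x i m))) ⟩
          (b * b ^ i) * (g₀ x + a * (x ^ i * x ^ m))
            ≈⟨ solve 7 (λ b c g a s t f → (b :* c) :* (g :+ a :* (s :* t)) :=
                          c :* (b :* g :- s :* (a :* f)) :+ (f :+ b :* t) :* ((c :* a) :* s))
                 refl b (b ^ i) (g₀ x) a (x ^ i) (x ^ m) (f₀ x) ⟩
          b ^ i * (b * g₀ x - x ^ i * (a * f₀ x)) + (f₀ x + b * x ^ m) * ((b ^ i * a) * x ^ i)
            ≈⟨ +-cong (eq x) (*-congʳ (sym (eqf x))) ⟩
          (f x * q x + r x) + f x * ((b ^ i * a) * x ^ i)
            ≈⟨ solve 4 (λ f q r t → (f :* q :+ r) :+ f :* t := f :* (q :+ t) :+ r)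
                 refl (f x) (q x) (r x) ((b ^ i * a) * x ^ i) ⟩
          f x * (q x + (b ^ i * a) * x ^ i) + r x              ∎

-- Finitely generated extensions of a subring of a field

module Adjunction (em : ∀ ℓ → ExcludedMiddle ℓ) (K : CommutativeRing c ℓ) (isField : IsField K) where
  open CommutativeRing K
  open Algebra.Properties.Ring ring using (x∙y⁻¹≈ε⇒x≈y; -0#≈0#; -‿involutive; x≈y⇒x∙y⁻¹≈ε)
  open Algebra.Properties.Semiring.Exp semiring using (_^_; ^-congˡ)
  open Algebra.Properties.CommutativeSemiring.Exp commutativeSemiring using (^-distrib-*)
  open IntegerCoefficients K
  open Solver using (solve; _:=_; con; _:+_; _:*_; _:-_; :-_)
  open Subrings K
  open Relation.Binary.Reasoning.Setoid setoid
  open IsField isField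

  infix 4 _≉0
  _≉0 : Carrier → Set ℓ
  x ≉0 = ¬ x ≈ 0#

  invert : ∀ {x} → x ≉0 → ∃[ y ] x * y ≈ 1#
  invert x≉0 = let y , _ , xy≈1 = invertible _ x≉0 in y , xy≈1

  *-cancel-zero : ∀ {x y} → x ≉0 → x * y ≈ 0# → y ≈ 0#
  *-cancel-zero {x} {y} x≉0 xy≈0 = let z , xz≈1 = invert x≉0 in begin
    y             ≈⟨ *-identityˡ y ⟨
    1# * y        ≈⟨ *-congʳ xz≈1 ⟨
    (x * z) * y   ≈⟨ solve 3 (λ x y z → (x :* z) :* y := z :* (x :* y)) refl x y z ⟩
    z * (x * y)   ≈⟨ *-congˡ xy≈0 ⟩
    z * 0#        ≈⟨ zeroʳ z ⟩
    0#            ∎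

  *-≉0 : ∀ {x y} → x ≉0 → y ≉0 → x * y ≉0
  *-≉0 x≉0 y≉0 xy≈0 = y≉0 (*-cancel-zero x≉0 xy≈0)

  ^-≉0 : ∀ {x} n → x ≉0 → x ^ n ≉0
  ^-≉0 zero    x≉0 = 1≉0
  ^-≉0 (suc n) x≉0 = *-≉0 x≉0 (^-≉0 n x≉0)

  *-≉0ˡ : ∀ {x y} → x * y ≉0 → x ≉0
  *-≉0ˡ xy≉0 x≈0 = xy≉0 (trans (*-congʳ x≈0) (zeroˡ _))

  *-≉0ʳ : ∀ {x y} → x * y ≉0 → y ≉0
  *-≉0ʳ xy≉0 y≈0 = xy≉0 (trans (*-congˡ y≈0) (zeroʳ _))

  neg-≉0 : ∀ {x} → x ≉0 → - x ≉0
  neg-≉0 {x} x≉0 -x≈0 = x≉0 (trans (sym (-‿involutive x)) (trans (-‿cong -x≈0) -0#≈0#))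

  module _ {P : Pred Carrier (c ⊔ ℓ)} (sub : IsSubring P) where
    open Polynomials K sub
    open IsSubring sub

    record Adjoin (s y : Carrier) : Set (c ⊔ ℓ) where
      constructor value
      field
        {length} : ℕ
        {poly}   : Carrier → Carrier
        isPoly   : Poly length poly
        evaluate : y ≈ poly s

    ⊆-Adjoin : ∀ s → P ⊆ Adjoin s
    ⊆-Adjoin s x∈ = value (Poly-const x∈) refl

    ∈-Adjoin : ∀ s → Adjoin s s
    ∈-Adjoin s = value (leading Leading-id) refl

    Adjoin-isSubring : ∀ s → IsSubring (Adjoin s)
    Adjoin-isSubring s = record
      { respects   = λ x≈y (value pf eq) → value pf (trans (sym x≈y) eq)
      ; 0∈         = ⊆-Adjoin s 0∈
      ; 1∈         = ⊆-Adjoin s 1∈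
      ; +-closed   = λ { (value {m} pf eqf) (value {n} pg eqg) →
          value (Poly-+ (Poly-≤ (ℕ.m≤m+n m n) pf) (Poly-≤ (ℕ.m≤n+m n m) pg)) (+-cong eqf eqg) }
      ; *-closed   = λ (value pf eqf) (value pg eqg) → value (Poly-* pf pg) (*-cong eqf eqg)
      ; neg-closed = λ (value pf eq) → value (Poly-neg pf) (-‿cong eq)
      }

    NoRelationBelow : ℕ → Carrier → Set (c ⊔ ℓ)
    NoRelationBelow m s = ∀ {n a f} → n < m → Leading n a f → a ≉0 → f s ≉0

    Transcendental : Carrier → Set (c ⊔ ℓ)
    Transcendental s = ∀ {n a f} → Leading n a f → a ≉0 → f s ≉0

    -- Coefficients are taken in `P` and not in its fraction field, so the polynomial cannot be made
    -- monic, and powers of `lead` appear as denominators from here on.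
    record MinimalPolynomial (s : Carrier) : Set (c ⊔ ℓ) where
      field
        {degree}     : ℕ
        {lead}       : Carrier
        {poly}       : Carrier → Carrier
        leading-poly : Leading degree lead poly
        lead≉0       : lead ≉0
        root         : poly s ≈ 0#
        minimal      : NoRelationBelow degree s

    minimalPolynomial? : ∀ s → MinimalPolynomial s ⊎ Transcendental s
    minimalPolynomial? s with em _ {∃[ n ] ∃[ a ] ∃[ f ] Leading n a f × a ≉0 × f s ≈ 0#}
    ... | no ¬rel = inj₂ λ l a≉0 fs≈0 → ¬rel (_ , _ , _ , l , a≉0 , fs≈0)
    ... | yes (n , rel) = inj₁ (<-rec _ descend n rel)
      where
      Relation : ℕ → Set (c ⊔ ℓ)
      Relation n = ∃[ a ] ∃[ f ] Leading n a f × a ≉0 × f s ≈ 0#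

      descend : ∀ n → (∀ {k} → k < n → Relation k → MinimalPolynomial s) →
                Relation n → MinimalPolynomial s
      descend n rec (_ , _ , l , a≉0 , fs≈0) with em _ {∃[ k ] k < n × Relation k}
      ... | yes (_ , k<n , rel) = rec k<n rel
      ... | no ¬smaller = record
        { leading-poly = l
        ; lead≉0       = a≉0
        ; root         = fs≈0
        ; minimal      = λ k<n l′ b≉0 gs≈0 → ¬smaller (_ , k<n , _ , _ , l′ , b≉0 , gs≈0)
        }

    drop-leading : ∀ {n a f} (l : Leading n a f) → a ≈ 0# → ∀ x → f x ≈ Leading.lower l x
    drop-leading {n} {a} {f} (leading-term {f₀} pf a∈ eq) a≈0 x = begin
      f x                ≈⟨ eq x ⟩
      f₀ x + a * x ^ n   ≈⟨ +-congˡ (*-congʳ a≈0) ⟩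
      f₀ x + 0# * x ^ n  ≈⟨ solve 2 (λ u v → u :+ con (+ 0) :* v := u) refl (f₀ x) (x ^ n) ⟩
      f₀ x               ∎

    record ExactDegree (s : Carrier) (n : ℕ) (y : Carrier) : Set (c ⊔ ℓ) where
      constructor exact
      field
        {degree} : ℕ
        {lead}   : Carrier
        {poly}   : Carrier → Carrier
        bound    : degree < n
        leads    : Leading degree lead poly
        lead≉0   : lead ≉0
        evaluate : y ≈ poly s

    -- Vanishing leading coefficients are dropped one by one; they cannot all vanish because the
    -- value at `s` is nonzero.
    exact-degree : ∀ {n f s} → Poly n f → f s ≉0 → ExactDegree s n (f s)
    exact-degree (vanishing f≈0) fs≉0 = ⊥-elim (fs≉0 (f≈0 _))
    exact-degree {f = f} {s} (leading {n} {a} l) fs≉0 with em _ {a ≈ 0#}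
    ... | no a≉0  = exact ℕ.≤-refl l a≉0 refl
    ... | yes a≈0 = lift (exact-degree (Leading.lower-poly l)
                       (λ f₀s≈0 → fs≉0 (trans (drop-leading l a≈0 s) f₀s≈0)))
      where
      lift : ExactDegree s n (Leading.lower l s) → ExactDegree s (suc n) (f s)
      lift (exact k<n l′ b≉0 eq) = exact (ℕ.m≤n⇒m≤1+n k<n) l′ b≉0 (trans (drop-leading l a≈0 s) eq)

    -- Minimality kills the coefficients one after another. An identity known only at `s` can then
    -- be evaluated elsewhere, at `0#` or at an element of `P`.
    vanishing-everywhere : ∀ {m n f s} → NoRelationBelow m s → n ≤ m → Poly n f → f s ≈ 0# →
                           ∀ x → f x ≈ 0#
    vanishing-everywhere none n≤m (vanishing f≈0) fs≈0 = f≈0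
    vanishing-everywhere {f = f} {s} none n≤m (leading {n} {a} l@(leading-term {f₀} pf a∈ eq)) fs≈0 x
      with em _ {a ≈ 0#}
    ... | no a≉0  = ⊥-elim (none n≤m l a≉0 fs≈0)
    ... | yes a≈0 = trans (drop-leading l a≈0 x)
          (vanishing-everywhere none (ℕ.<⇒≤ n≤m) pf (trans (sym (drop-leading l a≈0 s)) fs≈0) x)

    module _ {s} (mp : MinimalPolynomial s) where
      open MinimalPolynomial mp

      private
        remainder≈ : ∀ {g k r : Carrier → Carrier} {b} i → (∀ x → b ^ i * poly x ≈ g x * k x + r x) → g s * (- k s) ≈ r s
        remainder≈ {g} {k} {r} {b} i eq = begin
          g s * (- k s)             ≈⟨ solve 3 (λ g k r → g :* (:- k) := r :- (g :* k :+ r)) refl (g s) (k s) (r s) ⟩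
          r s - (g s * k s + r s)   ≈⟨ +-congˡ (-‿cong (eq s)) ⟨
          r s - b ^ i * poly s      ≈⟨ +-congˡ (-‿cong (*-congˡ root)) ⟩
          r s - b ^ i * 0#          ≈⟨ solve 2 (λ r a → r :- a :* con (+ 0) := r) refl (r s) (b ^ i) ⟩
          r s                       ∎

        -- A zero remainder would make s a root of the quotient k.
        remainder≉0 : ∀ {n a} {g k r : Carrier → Carrier} i → i ℕ.+ suc n ≡ degree → suc n < degree → Leading (suc n) a g → a ≉0 →
                      Leading i (a ^ i * lead) k →
                      (∀ x → a ^ suc i * poly x ≈ g x * k x + r x) → r s ≉0
        remainder≉0 {g = g} {k} {r} i i+n≡d n<d lg a≉0 lk eq r≈0 =
          *-≉0 (minimal n<d lg a≉0)
               (neg-≉0 (minimal (≡.subst (i <_) i+n≡d (ℕ.m<m+n i (s≤s z≤n))) lk (*-≉0 (^-≉0 i a≉0) lead≉0)))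
               (trans (remainder≈ {g} {k} {r} (suc i) eq) r≈0)

      private
        record LowerMultiple (n : ℕ) (y : Carrier) : Set (c ⊔ ℓ) where
          constructor lower-degree
          field
            {multiple} : Carrier
            exact-mult : ExactDegree s n multiple
            is-mult    : y ∣ multiple within Adjoin s

        -- Dividing the minimal polynomial by `g` and evaluating at `s` shows that the remainder is,
        -- up to sign, the quotient times `g s`. So `g s` has a nonzero multiple of smaller degree.
        lower-multiple : ∀ {n a g} → suc n < degree → Leading (suc n) a g → a ≉0 →
                         LowerMultiple (suc n) (g s)
        lower-multiple {n} {a} {g} n<d lg a≉0 = result (pseudo-divide-leading i lg
            (≡.subst (λ d → Leading d lead poly) (≡.sym i+n≡d) leading-poly))
          where
          i = degree ℕ.∸ suc n

          i+n≡d : i ℕ.+ suc n ≡ degree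
          i+n≡d = ℕ.m∸n+n≡m (ℕ.<⇒≤ n<d)

          result : PseudoDivision (Leading i (a ^ i * lead)) (suc n) (suc i) a g poly →
                   LowerMultiple (suc n) (g s)
          result (pseudo-division {k} {r} lk pr eq) = lower-degree
            (exact-degree pr (remainder≉0 {g = g} {k} {r} i i+n≡d n<d lg a≉0 lk eq))
            (divides (IsSubring.neg-closed (Adjoin-isSubring s) (value (leading lk) refl))
                     (remainder≈ {g} {k} {r} (suc i) eq))

      -- A substitute for the norm of `y` from `P[s]` to `P`.
      record MultipleInBase (y : Carrier) : Set (c ⊔ ℓ) where
        constructor multiple
        field
          {multiple} : Carrier
          multiple∈  : P multiple
          multiple≉0 : multiple ≉0
          is-mult    : y ∣ multiple within Adjoin s

      multiple-trans : ∀ {x y} → x ∣ y within Adjoin s → MultipleInBase y → MultipleInBase x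
      multiple-trans x∣y (multiple h∈ h≉0 y∣h) =
        multiple h∈ h≉0 (∣-trans (Adjoin-isSubring s) x∣y y∣h)

      -- Repeated passage to multiples of lower degree ends at a nonzero constant, which is the
      -- leading coefficient of a polynomial of degree 0 and so lies in `P`.
      multiple-in-base-of-exact : ∀ n {y} → n ≤ degree → ExactDegree s n y → MultipleInBase y
      multiple-in-base-of-exact (suc n) n≤d
        (exact {zero} {a} {g} _ (leading-term {g₀} (vanishing g₀≈0) a∈ eq) a≉0 y≈gs) =
        multiple a∈ a≉0 (≈⇒∣ (Adjoin-isSubring s) (trans y≈gs (begin
          g s            ≈⟨ eq s ⟩
          g₀ s + a * 1#  ≈⟨ +-congʳ (g₀≈0 s) ⟩
          0# + a * 1#    ≈⟨ solve 1 (λ a → con (+ 0) :+ a :* con (+ 1) := a) refl a ⟩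
          a              ∎)))
      multiple-in-base-of-exact (suc n) n≤d (exact {suc k} (s≤s k<n) lg a≉0 y≈gs) =
        multiple-trans (≈⇒∣ (Adjoin-isSubring s) y≈gs) (descend (lower-multiple (ℕ.≤-trans (s≤s k<n) n≤d) lg a≉0))
        where
        descend : ∀ {x} → LowerMultiple (suc k) x → MultipleInBase x
        descend (lower-degree (exact j<k lr b≉0 eq) x∣y) = multiple-trans x∣y
          (multiple-in-base-of-exact n (ℕ.<⇒≤ n≤d) (exact (ℕ.≤-trans j<k k<n) lr b≉0 eq))

      record Reduced (n : ℕ) (y : Carrier) : Set (c ⊔ ℓ) where
        constructor reduced
        field
          {remainder}    : Carrier → Carrier
          remainder-poly : Poly degree remainder
          equation       : lead ^ n * y ≈ remainder s

      reduce : ∀ {n g} → Poly n g → Reduced n (g s)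
      reduce {n} {g} pg = result (pseudo-divide n leading-poly (Poly-≤ (ℕ.m≤m+n n degree) pg))
        where
        result : PseudoDivision (Poly n) degree n lead poly g → Reduced n (g s)
        result (pseudo-division {k} {r} pk pr eq) = reduced pr (begin
          lead ^ n * g s        ≈⟨ eq s ⟩
          poly s * k s + r s    ≈⟨ +-congʳ (*-congʳ root) ⟩
          0# * k s + r s        ≈⟨ solve 2 (λ k r → con (+ 0) :* k :+ r := r) refl (k s) (r s) ⟩
          r s                   ∎)

      multiple-in-base : ∀ {w} → Adjoin s w → w ≉0 → MultipleInBase w
      multiple-in-base {w} (value {n} {g} pg w≈gs) w≉0 = result (reduce pg)
        where
        result : Reduced n (g s) → MultipleInBase w
        result (reduced {r} pr eq) = multiple-trans
          (divides (⊆-Adjoin s (^-closed n (Leading.lead∈ leading-poly)))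
                   (trans (*-comm _ _) eq′))
          (multiple-in-base-of-exact degree ℕ.≤-refl
            (exact-degree pr (λ r≈0 → *-≉0 (^-≉0 n lead≉0) w≉0 (trans eq′ r≈0))))
          where
          eq′ : lead ^ n * w ≈ r s
          eq′ = trans (*-congˡ w≈gs) eq

    -- Otherwise the difference of `f` and `g` has a nonzero leading coefficient and vanishes at
    -- `s`.
    leading-unique : ∀ {s m n a b f g} → Transcendental s → Leading m a f → a ≉0 →
                     Leading n b g → b ≉0 → f s ≈ g s → a ≈ b
    leading-unique {s} {m} {n} {a} {b} {f} {g} tr lf a≉0 lg b≉0 fs≈gs with ℕ.<-cmp m n
    ... | tri< m<n _ _ = ⊥-elim (tr (Leading-+ lg (Poly-neg (Poly-≤ m<n (leading lf)))) b≉0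
                                    (x≈y⇒x∙y⁻¹≈ε (sym fs≈gs)))
    ... | tri> _ _ n<m = ⊥-elim (tr (Leading-+ lf (Poly-neg (Poly-≤ n<m (leading lg)))) a≉0
                                    (x≈y⇒x∙y⁻¹≈ε fs≈gs))
    ... | tri≈ _ ≡.refl _ with em _ {a + - 1# * b ≈ 0#}
    ...   | yes a-b≈0 = x∙y⁻¹≈ε⇒x≈y a b (trans (minus-scale a b) a-b≈0)
      where
      minus-scale : ∀ x y → x - y ≈ x + - 1# * y
      minus-scale = solve 2 (λ x y → x :- y := x :+ (:- con (+ 1)) :* y) refl
    ...   | no a-b≉0 = ⊥-elim
      (tr (Leading-+-Leading lf (Leading-scale (neg-closed 1∈) lg)) a-b≉0 (begin
        f s + - 1# * g s   ≈⟨ +-congʳ fs≈gs ⟩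
        g s + - 1# * g s   ≈⟨ solve 1 (λ y → y :+ (:- con (+ 1)) :* y := con (+ 0)) refl (g s) ⟩
        0#                 ∎))

    record PowerMultiple (u h : Carrier) : Set (c ⊔ ℓ) where
      constructor power-multiple
      field
        exponent : ℕ
        divisor  : u ∣ h ^ exponent within P

    -- Powers of an arbitrary `w` are needed even if only units are of interest: going down a tower
    -- of extensions, the bound found at one level is the `w` of the next.
    record Control (Q : Pred Carrier (c ⊔ ℓ)) (w : Carrier) : Set (c ⊔ ℓ) where
      constructor control
      field
        {bound} : Carrier
        bound∈  : P bound
        bound≉0 : bound ≉0
        bounds  : ∀ {u} N → P u → u ∣ w ^ N within Q → PowerMultiple u bound

    0<degree : ∀ {s} (mp : MinimalPolynomial s) → 0 < MinimalPolynomial.degree mp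
    0<degree {s} mp = positive leading-poly root
      where
      open MinimalPolynomial mp
      positive : ∀ {n f} → Leading n lead f → f s ≈ 0# → 0 < n
      positive {suc _} _ _ = s≤s z≤n
      positive {zero} {f} (leading-term {f₀} (vanishing f₀≈0) _ eq) fs≈0 = ⊥-elim (lead≉0 (begin
        lead                 ≈⟨ solve 1 (λ a → a := con (+ 0) :+ a :* con (+ 1)) refl lead ⟩
        0# + lead * 1#       ≈⟨ +-congʳ (f₀≈0 s) ⟨
        f₀ s + lead * 1#     ≈⟨ eq s ⟨
        f s                  ≈⟨ fs≈0 ⟩
        0#                   ∎))

    -- Replacing `w` by a multiple `h` in `P` and reducing the cofactor modulo the minimal
    -- polynomial gives `u * r s ≈ lead ^ n * h ^ N` with `r` of degree below the minimal one. Such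
    -- an identity holds coefficient by coefficient, so `u` divides the right-hand side within `P`.
    control-algebraic : ∀ {s w} → MinimalPolynomial s → Adjoin s w → w ≉0 → Control (Adjoin s) w
    control-algebraic {s} {w} mp w∈ w≉0 = result (multiple-in-base mp w∈ w≉0)
      where
      open MinimalPolynomial mp
      open Leading leading-poly using () renaming (lead∈ to e∈)
      module A = IsSubring (Adjoin-isSubring s)

      result : MultipleInBase mp w → Control (Adjoin s) w
      result (multiple {h} h∈ h≉0 (divides {v} v∈ wv≈h)) = control (*-closed e∈ h∈) (*-≉0 lead≉0 h≉0) bounds
        where
        bounds : ∀ {u} N → P u → u ∣ w ^ N within Adjoin s → PowerMultiple u (lead * h)
        bounds {u} N u∈ (divides {q} q∈ uq≈wᴺ) = clear (A.*-closed q∈ (A.^-closed N v∈))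
          where
          uqv≈hᴺ : u * (q * v ^ N) ≈ h ^ N
          uqv≈hᴺ = begin
            u * (q * v ^ N)   ≈⟨ *-assoc _ _ _ ⟨
            (u * q) * v ^ N   ≈⟨ *-congʳ uq≈wᴺ ⟩
            w ^ N * v ^ N     ≈⟨ ^-distrib-* w v N ⟨
            (w * v) ^ N       ≈⟨ ^-congˡ N wv≈h ⟩
            h ^ N             ∎

          clear : Adjoin s (q * v ^ N) → PowerMultiple u (lead * h)
          clear (value {n} {g} pg qv≈gs) = finish (reduce mp pg)
            where
            finish : Reduced mp n (g s) → PowerMultiple u (lead * h)
            finish (reduced {r} pr eq) = power-multiple (n ℕ.+ N)
              -- Evaluation at `0#` selects the constant term of `r`, which is the quotient in `P`.
              (∣-trans sub (divides (Poly-closed pr 0∈) (x∙y⁻¹≈ε⇒x≈y _ _ (difference≈0 0#)))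
                           (^*^-∣-^ sub e∈ h∈ n N))
              where
              root-of-difference : u * r s - lead ^ n * h ^ N ≈ 0#
              root-of-difference = x≈y⇒x∙y⁻¹≈ε (begin
                u * r s                         ≈⟨ *-congˡ eq ⟨
                u * (lead ^ n * g s)            ≈⟨ *-congˡ (*-congˡ qv≈gs) ⟨
                u * (lead ^ n * (q * v ^ N))    ≈⟨ solve 3 (λ u e y → u :* (e :* y) := e :* (u :* y)) refl u (lead ^ n) (q * v ^ N) ⟩
                lead ^ n * (u * (q * v ^ N))    ≈⟨ *-congˡ uqv≈hᴺ ⟩
                lead ^ n * h ^ N                ∎)

              difference≈0 : ∀ x → u * r x - lead ^ n * h ^ N ≈ 0#
              difference≈0 = vanishing-everywhere minimal ℕ.≤-refl
                (Poly-+ (Poly-scale u∈ pr)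
                        (Poly-≤ (0<degree mp) (Poly-const (neg-closed (*-closed (^-closed n e∈) (^-closed N h∈))))))
                root-of-difference

    -- `P[s]` behaves like a polynomial ring, where leading coefficients multiply; hence `u` divides
    -- a power of the leading coefficient of `w`.
    control-transcendental : ∀ {s w} → Transcendental s → Adjoin s w → w ≉0 → Control (Adjoin s) w
    control-transcendental {s} {w} tr (value pf w≈fs) w≉0 =
      result (exact-degree pf (λ fs≈0 → w≉0 (trans w≈fs fs≈0)))
      where
      result : ∀ {n} → ExactDegree s n _ → Control (Adjoin s) w
      result (exact {a} {lead = a₀} {g} _ lg a≉0 fs≈gs) = control (Leading.lead∈ lg) a≉0 bounds
        where
        bounds : ∀ {u} N → P u → u ∣ w ^ N within Adjoin s → PowerMultiple u a₀
        bounds {u} N u∈ (divides {q} (value {m} {k} pk q≈ks) uq≈wᴺ) =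
          compare (exact-degree pk (λ ks≈0 → *-≉0ʳ uq≉0 (trans q≈ks ks≈0)))
          where
          uq≉0 : u * q ≉0
          uq≉0 uq≈0 = ^-≉0 N w≉0 (trans (sym uq≈wᴺ) uq≈0)

          compare : ExactDegree s m (k s) → PowerMultiple u a₀
          compare (exact {lead = b} {k′} _ lk b≉0 ks≈k′s) = power-multiple N
            (divides (Leading.lead∈ lk)
              (leading-unique tr (Leading-scale u∈ lk) (*-≉0 (*-≉0ˡ uq≉0) b≉0)
                                 (Leading-^ lg N) (^-≉0 N a≉0) (begin
                u * k′ s    ≈⟨ *-congˡ (trans q≈ks ks≈k′s) ⟨
                u * q       ≈⟨ uq≈wᴺ ⟩
                w ^ N       ≈⟨ ^-congˡ N (trans w≈fs fs≈gs) ⟩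
                g s ^ N     ∎)))

    control-Adjoin : ∀ {s w} → Adjoin s w → w ≉0 → Control (Adjoin s) w
    control-Adjoin {s} w∈ w≉0 with minimalPolynomial? s
    ... | inj₁ mp = control-algebraic mp w∈ w≉0
    ... | inj₂ tr = control-transcendental tr w∈ w≉0

  Adjoin* : {P : Pred Carrier (c ⊔ ℓ)} → IsSubring P → List Carrier → Pred Carrier (c ⊔ ℓ)
  Adjoin* {P} sub []       = P
  Adjoin*     sub (s ∷ ss) = Adjoin* (Adjoin-isSubring sub s) ss

  Adjoin*-isSubring : ∀ {P} (sub : IsSubring P) ss → IsSubring (Adjoin* sub ss)
  Adjoin*-isSubring sub []       = sub
  Adjoin*-isSubring sub (s ∷ ss) = Adjoin*-isSubring (Adjoin-isSubring sub s) ss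

  ⊆-Adjoin* : ∀ {P} (sub : IsSubring P) ss → P ⊆ Adjoin* sub ss
  ⊆-Adjoin* sub []       x∈ = x∈
  ⊆-Adjoin* sub (s ∷ ss) x∈ = ⊆-Adjoin* (Adjoin-isSubring sub s) ss (⊆-Adjoin sub s x∈)

  ∈-Adjoin* : ∀ {P} (sub : IsSubring P) {s ss} → s ∈ˡ ss → Adjoin* sub ss s
  ∈-Adjoin* sub {ss = s ∷ ss} (here ≡.refl) = ⊆-Adjoin* (Adjoin-isSubring sub s) ss (∈-Adjoin sub s)
  ∈-Adjoin* sub {ss = s ∷ ss} (there s∈)    = ∈-Adjoin* (Adjoin-isSubring sub s) s∈

  -- Units of a finitely generated extension: with w = 1, an element of P which is
  -- invertible in P[s₁, …, sₙ] divides a power of a fixed h in P.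
  control-Adjoin* : ∀ {P} (sub : IsSubring P) ss {w} → Adjoin* sub ss w → w ≉0 →
                    Control sub (Adjoin* sub ss) w
  control-Adjoin* sub []       w∈ w≉0 = control w∈ w≉0 (λ N _ → power-multiple N)
  control-Adjoin* sub (s ∷ ss) w∈ w≉0 = compose (control-Adjoin* (Adjoin-isSubring sub s) ss w∈ w≉0)
    where
    compose : ∀ {w} → Control (Adjoin-isSubring sub s) (Adjoin* sub (s ∷ ss)) w →
              Control sub (Adjoin* sub (s ∷ ss)) w
    compose (control h∈ h≉0 bounds) = compose′ (control-Adjoin sub h∈ h≉0)
      where
      compose′ : Control sub (Adjoin sub s) _ → Control sub (Adjoin* sub (s ∷ ss)) _
      compose′ (control h′∈ h′≉0 bounds′) = control h′∈ h′≉0 λ N u∈ u∣wᴺ →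
        chain u∈ (bounds N (⊆-Adjoin sub s u∈) u∣wᴺ)
        where
        chain : ∀ {u} → _ → PowerMultiple (Adjoin-isSubring sub s) u _ → PowerMultiple sub u _
        chain u∈ (power-multiple M u∣hᴹ) = bounds′ M u∈ u∣hᴹ

-- Roots of polynomials; norms for transcendental d

module Roots (em : ∀ ℓ → ExcludedMiddle ℓ) (K : CommutativeRing c ℓ) (isField : IsField K)
             {P : Pred (CommutativeRing.Carrier K) (c ⊔ ℓ)} (sub : Subrings.IsSubring K P) where
  open CommutativeRing K
  open Algebra.Properties.Ring ring using (x≈y⇒x∙y⁻¹≈ε; -0#≈0#)
  open Algebra.Properties.Semiring.Exp semiring using (_^_)
  open IntegerCoefficients K
  open Solver using (solve; _:=_; con; _:+_; _:*_; _:-_; :-_)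
  open Subrings K
  open Polynomials K sub
  open Adjunction em K isField
  open IsField isField
  open IsSubring sub
  open Relation.Binary.Reasoning.Setoid setoid

  private
    Poly-1-constant : ∀ {f} → Poly 1 f → ∀ x y → f x ≈ f y
    Poly-1-constant (leading (leading-term (vanishing f₀≈0) _ eq)) x y =
      trans (eq x) (trans (+-congʳ (trans (f₀≈0 x) (sym (f₀≈0 y)))) (sym (eq y)))

  -- Pseudo-division by `x - y` returns the leading coefficient `1# ^ n * a`; only its being nonzero
  -- is recorded.
  record Factor (n : ℕ) (a y : Carrier) (f : Carrier → Carrier) : Set (c ⊔ ℓ) where
    constructor factor
    field
      {lead}   : Carrier
      {quotient} : Carrier → Carrier
      leads    : Leading n lead quotient
      lead≉0   : a ≉0 → lead ≉0
      equation : ∀ x → f x ≈ f y + (x - y) * quotient x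

  factor-theorem : ∀ {n a f y} → P y → Leading (suc n) a f → Factor n a y f
  factor-theorem {n} {a} {f} {y} y∈ lf = result
    (pseudo-divide-leading n linear (≡.subst (λ k → Leading k a f) (ℕ.+-comm 1 n) lf))
    where
    linear : Leading 1 1# (λ x → x - y)
    linear = Leading-+ Leading-id (Poly-const (neg-closed y∈))

    result : PseudoDivision (Leading n (1# ^ n * a)) 1 (suc n) 1# (λ x → x - y) f → Factor n a y f
    result (pseudo-division {k} {r} lk pr eq) = factor lk (*-≉0 (^-≉0 n 1≉0)) λ x → begin
      f x                                    ≈⟨ eq′ x ⟩
      (x - y) * k x + r x                    ≈⟨ +-congˡ (Poly-1-constant pr x y) ⟩
      (x - y) * k x + r y
        ≈⟨ solve 4 (λ x y k r → (x :- y) :* k :+ r := r :+ (x :- y) :* k) refl x y (k x) (r y) ⟩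
      r y + (x - y) * k x
        ≈⟨ +-congʳ (solve 3 (λ y k r → (y :- y) :* k :+ r := r) refl y (k y) (r y)) ⟨
      ((y - y) * k y + r y) + (x - y) * k x  ≈⟨ +-congʳ (eq′ y) ⟨
      f y + (x - y) * k x                    ∎
      where
      eq′ : ∀ x → f x ≈ (x - y) * k x + r x
      eq′ x = trans (trans (sym (*-identityˡ _)) (*-congʳ (sym (1^n≈1 (suc n))))) (eq x)

  -- An infinite sequence of points avoids counting: dividing by `x - y 0` lowers the degree and
  -- leaves the sequence `y ∘ suc` of the same kind.
  finitely-many-roots : ∀ n {a f} → Leading n a f → a ≉0 → (y : ℕ → Carrier) → (∀ i → P (y i)) →
                        (∀ {i j} → i < j → y i - y j ≉0) → ¬ (∀ i → f (y i) ≈ 0#)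
  finitely-many-roots zero {a} {f} (leading-term {f₀} (vanishing f₀≈0) _ eq) a≉0 y y∈ distinct roots =
    a≉0 (begin
      a                       ≈⟨ solve 1 (λ a → a := con (+ 0) :+ a :* con (+ 1)) refl a ⟩
      0# + a * 1#             ≈⟨ +-congʳ (f₀≈0 (y 0)) ⟨
      f₀ (y 0) + a * 1#       ≈⟨ eq (y 0) ⟨
      f (y 0)                 ≈⟨ roots 0 ⟩
      0#                      ∎)
  finitely-many-roots (suc n) {a} {f} lf a≉0 y y∈ distinct roots = step (factor-theorem (y∈ 0) lf)
    where
    step : Factor n a (y 0) f → ⊥
    step (factor {quotient = k} lk lead≉0 eq) =
      finitely-many-roots n lk (lead≉0 a≉0) (y ∘ suc) (y∈ ∘ suc) (distinct ∘ s≤s) λ i →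
        *-cancel-zero (λ y≈ → distinct {0} {suc i} (s≤s z≤n) (begin
            y 0 - y (suc i)        ≈⟨ solve 2 (λ u v → u :- v := :- (v :- u)) refl (y 0) (y (suc i)) ⟩
            - (y (suc i) - y 0)    ≈⟨ -‿cong y≈ ⟩
            - 0#                   ≈⟨ -0#≈0# ⟩
            0#                     ∎))
          (begin
            (y (suc i) - y 0) * k (y (suc i))            ≈⟨ +-identityˡ _ ⟨
            0# + (y (suc i) - y 0) * k (y (suc i))       ≈⟨ +-congʳ (roots 0) ⟨
            f (y 0) + (y (suc i) - y 0) * k (y (suc i))  ≈⟨ eq (y (suc i)) ⟨
            f (y (suc i))                                ≈⟨ roots (suc i) ⟩
            0#                                           ∎)

  -- Otherwise the polynomial is `x` times a quotient of smaller degree, and `s`, being nonzero, is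
  -- a root of that quotient.
  constant-term≉0 : ∀ {s} (mp : MinimalPolynomial sub s) → s ≉0 → MinimalPolynomial.poly mp 0# ≉0
  constant-term≉0 {s} mp s≉0 p0≈0 = go (0<degree sub mp) leading-poly minimal
    where
    open MinimalPolynomial mp
    go : ∀ {n} → 0 < n → Leading n lead poly → NoRelationBelow sub n s → ⊥
    go {suc n} _ lp none = split (factor-theorem 0∈ lp)
      where
      split : Factor n lead 0# poly → ⊥
      split (factor {quotient = k} lk k≉0 eq) = none ℕ.≤-refl lk (k≉0 lead≉0) (*-cancel-zero s≉0 (begin
        s * k s                   ≈⟨ solve 2 (λ s k → s :* k := con (+ 0) :+ (s :- con (+ 0)) :* k) refl s (k s) ⟩
        0# + (s - 0#) * k s       ≈⟨ +-congʳ p0≈0 ⟨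
        poly 0# + (s - 0#) * k s  ≈⟨ eq s ⟨
        poly s                    ≈⟨ root ⟩
        0#                        ∎))

  -- Modulo y − s the minimal polynomial takes the value poly(y), so y − s ∣ h passes
  -- from P[s] to poly(y) ∣ h up to leading coefficients.
  minimal-value-divides : ∀ {s y h} (mp : MinimalPolynomial sub s) → P y → P h →
                          (y - s) ∣ h within Adjoin sub s → let open MinimalPolynomial mp in
                          ∃[ N ] poly y ∣ lead ^ N * h within P
  minimal-value-divides {s} {y} {h} mp y∈ h∈ (divides {q} (value {n} {g} pg q≈gs) eq) =
    finish (pseudo-divide (2 ℕ.+ n) leading-poly (Poly-≤ (ℕ.m≤m+n (2 ℕ.+ n) degree) polyF))
    where
    open MinimalPolynomial mp
    -- `F` vanishes at `s`, so up to a power of `lead` it is a multiple of the minimal polynomial;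
    -- at `x = y` its first summand disappears and `- h` remains.
    F : Carrier → Carrier
    F x = (- 1# * x + y) * g x - h

    polyF : Poly (2 ℕ.+ n) F
    polyF = Poly-+ (Poly-* (Poly-+ (Poly-scale (neg-closed 1∈) (leading Leading-id))
                                   (Poly-≤ (s≤s z≤n) (Poly-const y∈))) pg)
                   (Poly-≤ (s≤s z≤n) (Poly-const (neg-closed h∈)))

    Fs≈0 : F s ≈ 0#
    Fs≈0 = x≈y⇒x∙y⁻¹≈ε (begin
      (- 1# * s + y) * g s  ≈⟨ *-cong (solve 2 (λ s y → :- con (+ 1) :* s :+ y := y :- s) refl s y) (sym q≈gs) ⟩
      (y - s) * q           ≈⟨ eq ⟩
      h                     ∎)

    finish : PseudoDivision (Poly (2 ℕ.+ n)) degree (2 ℕ.+ n) lead poly F →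
             ∃[ N ] poly y ∣ lead ^ N * h within P
    finish (pseudo-division {k} {r} pk pr eqF) = 2 ℕ.+ n ,
      divides (neg-closed (Poly-closed pk y∈)) (begin
        poly y * (- k y)
          ≈⟨ solve 2 (λ p k → p :* (:- k) := :- (p :* k :+ con (+ 0))) refl (poly y) (k y) ⟩
        - (poly y * k y + 0#)
          ≈⟨ -‿cong (+-congˡ (r≈0 y)) ⟨
        - (poly y * k y + r y)
          ≈⟨ -‿cong (eqF y) ⟨
        - (E * F y)
          ≈⟨ solve 4 (λ e y g h → :- (e :* ((:- con (+ 1) :* y :+ y) :* g :- h)) := e :* h) refl
               E y (g y) h ⟩
        E * h ∎)
      where
      E = lead ^ (2 ℕ.+ n)

      r≈0 : ∀ x → r x ≈ 0#
      r≈0 = vanishing-everywhere sub minimal ℕ.≤-refl pr (begin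
        r s                    ≈⟨ solve 2 (λ k r → r := con (+ 0) :* k :+ r) refl (k s) (r s) ⟩
        0# * k s + r s         ≈⟨ +-congʳ (*-congʳ root) ⟨
        poly s * k s + r s     ≈⟨ eqF s ⟨
        E * F s                ≈⟨ *-congˡ Fs≈0 ⟩
        E * 0#                 ≈⟨ zeroʳ _ ⟩
        0#                     ∎)

  -- With n = h d² the norm n² + n − d is −d (1 + h q), so 1 + h q is a unit of P[d],
  -- which its degree in d forbids.
  norms-not-bounded-transcendental : ∀ {d h} → Transcendental sub d → Adjoin sub d h → h ≉0 →
    ¬ (∀ {n} → Adjoin sub d n → PowerMultiple (Adjoin-isSubring sub d) (n * n + n - d) h)
  norms-not-bounded-transcendental {d} {h} tr h∈@(value ph h≈) h≉0 norms =
    contradict (exact-degree sub ph (λ H≈0 → h≉0 (trans h≈ H≈0)))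
               (unit (norms (*-closed′ d∈ (*-closed′ h∈ d∈))))
    where
    open IsSubring (Adjoin-isSubring sub d) using () renaming
      (*-closed to *-closed′; +-closed to +-closed′; neg-closed to neg-closed′)
    d∈ = ∈-Adjoin sub d

    q : Carrier
    q = - (d + d * (d * (d * h)))

    unit : PowerMultiple (Adjoin-isSubring sub d) ((d * (h * d)) * (d * (h * d)) + d * (h * d) - d) h →
           (1# + h * q) ∣ 1# within Adjoin sub d
    unit (power-multiple M (divides {a} a∈ eq)) = coprime-divisor (Adjoin-isSubring sub d) h∈
      (neg-closed′ (+-closed′ d∈ (*-closed′ d∈ (*-closed′ d∈ (*-closed′ d∈ h∈))))) M
      (divides (neg-closed′ (*-closed′ d∈ a∈)) (begin
        (1# + h * q) * (- (d * a))
          ≈⟨ solve 3 (λ h d a → (con (+ 1) :+ h :* (:- (d :+ d :* (d :* (d :* h))))) :* (:- (d :* a)) :=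
                        ((d :* (h :* d)) :* (d :* (h :* d)) :+ d :* (h :* d) :- d) :* a) refl h d a ⟩
        ((d * (h * d)) * (d * (h * d)) + d * (h * d) - d) * a
          ≈⟨ eq ⟩
        h ^ M ∎))

    contradict : ∀ {m} → ExactDegree sub d m _ → (1# + h * q) ∣ 1# within Adjoin sub d → ⊥
    contradict (exact {j} {a} {H} _ lH a≉0 H≈) (divides {v} (value {k} {V} pV v≈) uv≈1) =
      compare (exact-degree sub pV v≉0)
      where
      h≈H : h ≈ H d
      h≈H = trans h≈ H≈

      v≉0 : V d ≉0
      v≉0 V≈0 = 1≉0 (trans (sym uv≈1) (trans (*-congˡ (trans v≈ V≈0)) (zeroʳ _)))

      -- The polynomial `1 - H x - H² x³`, with value `1 + h q` at `d`. Its degree `2j + 3` is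
      -- positive, so its product with any polynomial `W` of exact degree cannot take the value 1 at
      -- the transcendental `d`.
      U : Carrier → Carrier
      U x = - 1# * (H x * (H x * (x * (x * x)))) + (- 1# * (H x * x) + 1#)

      leads-U : Leading (j ℕ.+ (j ℕ.+ 3)) (- 1# * (a * (a * (1# * (1# * 1#))))) U
      leads-U = Leading-+
        (Leading-scale (neg-closed 1∈) (Leading-* lH (Leading-* lH
          (Leading-* Leading-id (Leading-* Leading-id Leading-id)))))
        (Poly-+ (Poly-≤ Hx-bound (Poly-scale (neg-closed 1∈) (leading (Leading-* lH Leading-id))))
                (Poly-≤ (ℕ.≤-trans (s≤s z≤n) Hx-bound) (Poly-const 1∈)))
        where
        Hx-bound : suc (j ℕ.+ 1) ≤ j ℕ.+ (j ℕ.+ 3)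
        Hx-bound = ℕ.≤-trans (ℕ.≤-reflexive (≡.sym (ℕ.+-suc j 1)))
          (ℕ.+-monoʳ-≤ j (ℕ.≤-trans (s≤s (s≤s z≤n)) (ℕ.m≤n+m 3 j)))

      u≈Ud : 1# + h * q ≈ U d
      u≈Ud = trans (+-congˡ (*-cong h≈H (-‿cong (+-congˡ (*-congˡ (*-congˡ (*-congˡ h≈H)))))))
        (solve 2 (λ h d → con (+ 1) :+ h :* (:- (d :+ d :* (d :* (d :* h)))) :=
                    :- con (+ 1) :* (h :* (h :* (d :* (d :* d)))) :+ (:- con (+ 1) :* (h :* d) :+ con (+ 1)))
               refl (H d) d)

      compare : ExactDegree sub d k (V d) → ⊥
      compare (exact {i} {b} {W} _ lW b≉0 V≈W) = tr
        (Leading-+ (Leading-* leads-U lW)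
          (Poly-≤ (ℕ.≤-trans (ℕ.≤-trans (s≤s z≤n) (ℕ.m≤n+m 3 j)) (ℕ.≤-trans (ℕ.m≤n+m _ j) (ℕ.m≤m+n _ i)))
            (Poly-const (neg-closed 1∈))))
        (*-≉0 (*-≉0 (neg-≉0 1≉0) (*-≉0 a≉0 (*-≉0 a≉0 (*-≉0 1≉0 (*-≉0 1≉0 1≉0))))) b≉0)
        (x≈y⇒x∙y⁻¹≈ε (begin
          U d * W d          ≈⟨ *-cong u≈Ud (trans v≈ V≈W) ⟨
          (1# + h * q) * v   ≈⟨ uv≈1 ⟩
          1#                 ∎))

-- The prime ring; norms for algebraic d

module PrimeRing (em : ∀ ℓ → ExcludedMiddle ℓ) (K : CommutativeRing c ℓ) (isField : IsField K) where
  open CommutativeRing K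
  open Algebra.Properties.Ring ring using (x∙y⁻¹≈ε⇒x≈y; x≈y⇒x∙y⁻¹≈ε)
  open Algebra.Properties.Semiring.Exp semiring using (_^_; ^-congˡ)
  open Algebra.Properties.CommutativeSemiring.Exp commutativeSemiring using (^-distrib-*)
  open IntegerCoefficients K
  open Solver using (solve; _:=_; con; _:+_; _:*_; _:-_)
  open Subrings K
  open Adjunction em K isField
  open IsField isField
  open Relation.Binary.Reasoning.Setoid setoid

  data Integer (x : Carrier) : Set (c ⊔ ℓ) where
    integer : ∀ i → x ≈ fromℤ i → Integer x

  Integer-isSubring : IsSubring Integer
  Integer-isSubring = record
    { respects   = λ { x≈y (integer i eq) → integer i (trans (sym x≈y) eq) }
    ; 0∈         = integer (+ 0) refl
    ; 1∈         = integer (+ 1) refl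
    ; +-closed   = λ { (integer i eq) (integer j eq′) → integer (i ℤ.+ j) (trans (+-cong eq eq′) (sym (fromℤ-+ i j))) }
    ; *-closed   = λ { (integer i eq) (integer j eq′) → integer (i ℤ.* j) (trans (*-cong eq eq′) (sym (fromℤ-* i j))) }
    ; neg-closed = λ { (integer i eq) → integer (ℤ.- i) (trans (-‿cong eq) (sym (fromℤ-neg i))) }
    }

  module CharacteristicZero (char0 : ∀ n → fromℕ (suc n) ≉0) where
    open Polynomials K Integer-isSubring
    open Roots em K isField Integer-isSubring
    open IsSubring Integer-isSubring

    fromℤ≈0⇒≡0 : ∀ i → fromℤ i ≈ 0# → i ≡ + 0
    fromℤ≈0⇒≡0 (+ zero)  _  = ≡.refl
    fromℤ≈0⇒≡0 (+ suc n) eq = ⊥-elim (char0 n eq)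
    fromℤ≈0⇒≡0 -[1+ n ]  eq = ⊥-elim (neg-≉0 (char0 n) eq)

    fromℤ-injective : ∀ i j → fromℤ i ≈ fromℤ j → i ≡ j
    fromℤ-injective i j eq = ℤ.i-j≡0⇒i≡j i j (fromℤ≈0⇒≡0 (i ℤ.- j) (begin
      fromℤ (i ℤ.- j)          ≈⟨ fromℤ-+ i (ℤ.- j) ⟩
      fromℤ i + fromℤ (ℤ.- j)  ≈⟨ +-congˡ (fromℤ-neg j) ⟩
      fromℤ i - fromℤ j        ≈⟨ x≈y⇒x∙y⁻¹≈ε eq ⟩
      0#                       ∎))

    -- A unit of ℤ is 1 or -1. Squaring removes the sign, so that a single polynomial equation
    -- covers both cases.
    unit-square : ∀ {u} → Integer u → u ∣ 1# within Integer → u * u ≈ 1#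
    unit-square {u} (integer i u≈i) (divides {v} (integer j v≈j) uv≈1) = begin
      u * u               ≈⟨ *-cong u≈i u≈i ⟩
      fromℤ i * fromℤ i   ≈⟨ fromℤ-* i i ⟨
      fromℤ (i ℤ.* i)     ≡⟨ ≡.cong fromℤ (square i ∣i∣≡1) ⟩
      1#                  ∎
      where
      ij≡1 : i ℤ.* j ≡ + 1
      ij≡1 = fromℤ-injective _ _ (trans (fromℤ-* i j) (trans (*-cong (sym u≈i) (sym v≈j)) uv≈1))

      ∣i∣≡1 : ∣ i ∣ ≡ 1
      ∣i∣≡1 = ℕ.m*n≡1⇒m≡1 ∣ i ∣ ∣ j ∣ (≡.trans (≡.sym (ℤ.abs-* i j)) (≡.cong ∣_∣ ij≡1))

      square : ∀ i → ∣ i ∣ ≡ 1 → i ℤ.* i ≡ + 1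
      square (+ 1)    ≡.refl = ≡.refl
      square -[1+ 0 ] ≡.refl = ≡.refl

    square≡ : ∀ i → i ℤ.* i ≡ + (∣ i ∣ ℕ.* ∣ i ∣)
    square≡ (+ n)    = ≡.sym (ℤ.pos-* n n)
    square≡ -[1+ n ] = ≡.refl

    -- Makes the multiples of a square of an integer available as images of natural numbers, with no
    -- sign to follow.
    square-natural : ∀ {x} → Integer x → x ≉0 → ∃[ t ] x * x ≈ fromℕ (suc t)
    square-natural {x} (integer i x≈i) x≉0 with ∣ i ∣ in eq
    ... | zero  = ⊥-elim (x≉0 (trans x≈i (reflexive (≡.cong fromℤ (ℤ.∣i∣≡0⇒i≡0 {i} eq)))))
    -- The witness is the predecessor of `suc n ℕ.* suc n`.
    ... | suc n = n ℕ.+ n ℕ.* suc n , (begin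
      x * x                        ≈⟨ *-cong x≈i x≈i ⟩
      fromℤ i * fromℤ i            ≈⟨ fromℤ-* i i ⟨
      fromℤ (i ℤ.* i)              ≡⟨ ≡.cong fromℤ (square≡ i) ⟩
      fromℕ (∣ i ∣ ℕ.* ∣ i ∣)      ≡⟨ ≡.cong (λ k → fromℕ (k ℕ.* k)) eq ⟩
      fromℕ (suc n ℕ.* suc n)      ∎)

    -- Let c be the value of the minimal polynomial p at 0.  For n divisible by (c h)² one
    -- gets p(n² + n) = c (1 + h q), where 1 + h q divides a power of h and so is ±1.
    norms-not-bounded-algebraic : ∀ {d h} → MinimalPolynomial Integer-isSubring d → d ≉0 →
      Adjoin Integer-isSubring d h → h ≉0 →
      ¬ (∀ {n} → Adjoin Integer-isSubring d n →
         PowerMultiple (Adjoin-isSubring Integer-isSubring d) (n * n + n - d) h)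
    norms-not-bounded-algebraic {d} {h} mp d≉0 h∈ h≉0 norms = go (multiple-in-base Integer-isSubring mp h∈ h≉0)
      where
      open MinimalPolynomial mp
      e∈ = Leading.lead∈ leading-poly
      c₀ = poly 0#

      c₀∈ : Integer c₀
      c₀∈ = Poly-closed (leading leading-poly) 0∈

      c₀≉0 : c₀ ≉0
      c₀≉0 = constant-term≉0 mp d≉0

      go : ¬ MultipleInBase Integer-isSubring mp h
      go (multiple {h′} h′∈ h′≉0 (divides {v} v∈ hv≈h′)) = choose (square-natural C∈ C≉0)
        where
        -- `lead` is included because divisibility in `ℤ[d]` comes down to the integers only up to
        -- powers of `lead`.
        H = lead * h′
        H∈ = *-closed e∈ h′∈
        C = c₀ * H

        C∈ : Integer C
        C∈ = *-closed c₀∈ H∈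

        C≉0 : C ≉0
        C≉0 = *-≉0 c₀≉0 (*-≉0 lead≉0 h′≉0)

        value-divides : ∀ {n} → Integer n → PowerMultiple Integer-isSubring (poly (n * n + n)) H
        value-divides {n} n∈ = from-norm (norms (⊆-Adjoin Integer-isSubring d n∈))
          where
          from-norm : PowerMultiple (Adjoin-isSubring Integer-isSubring d) (n * n + n - d) h →
                      PowerMultiple Integer-isSubring (poly (n * n + n)) H
          from-norm (power-multiple M f∣hᴹ) = finish (minimal-value-divides mp
            (+-closed (*-closed n∈ n∈) n∈) (^-closed M h′∈)
            (∣-trans (Adjoin-isSubring Integer-isSubring d) f∣hᴹ
              (divides (IsSubring.^-closed (Adjoin-isSubring Integer-isSubring d) M v∈)
                (trans (sym (^-distrib-* h v M)) (^-congˡ M hv≈h′)))))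
            where
            finish : ∃[ N ] poly (n * n + n) ∣ lead ^ N * h′ ^ M within Integer →
                     PowerMultiple Integer-isSubring (poly (n * n + n)) H
            finish (N , p∣) = power-multiple (N ℕ.+ M)
              (∣-trans Integer-isSubring p∣ (^*^-∣-^ Integer-isSubring e∈ h′∈ N M))

        choose : ¬ (∃[ t ] C * C ≈ fromℕ (suc t))
        choose (t , CC≈T) = split (0<degree Integer-isSubring mp) leading-poly
          where
          N : ℕ → ℕ
          N j = suc t ℕ.* j

          n y : ℕ → Carrier
          n j = fromℕ (N j)
          y j = n j * n j + n j

          n∈ : ∀ j → Integer (n j)
          n∈ j = integer (+ N j) refl

          y∈ : ∀ j → Integer (y j)
          y∈ j = +-closed (*-closed (n∈ j) (n∈ j)) (n∈ j)

          y-natural : ∀ j → y j ≈ fromℕ (N j ℕ.* N j ℕ.+ N j)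
          y-natural j = sym (trans (fromℤ-+ (+ (N j ℕ.* N j)) (+ N j)) (+-congʳ
            (trans (reflexive (≡.cong fromℤ (ℤ.pos-* (N j) (N j)))) (fromℤ-* (+ N j) (+ N j)))))

          N-mono : ∀ {i j} → i < j → N i < N j
          N-mono = ℕ.*-monoʳ-< (suc t)

          y-distinct : ∀ {i j} → i < j → y i - y j ≉0
          y-distinct {i} {j} i<j yi-yj≈0 = ℕ.<⇒≢ (ℕ.+-mono-< (ℕ.*-mono-< (N-mono i<j) (N-mono i<j)) (N-mono i<j))
            (ℤ.+-injective (fromℤ-injective (+ (N i ℕ.* N i ℕ.+ N i)) (+ (N j ℕ.* N j ℕ.+ N j))
              (trans (sym (y-natural i)) (trans (x∙y⁻¹≈ε⇒x≈y _ _ yi-yj≈0) (y-natural j)))))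

          n≈CCj : ∀ j → n j ≈ (C * C) * fromℕ j
          n≈CCj j = trans (reflexive (≡.cong fromℤ (ℤ.pos-* (suc t) j)))
            (trans (fromℤ-* (+ suc t) (+ j)) (*-congʳ (sym CC≈T)))

          split : ∀ {m} → 0 < m → Leading m lead poly → ⊥
          split {suc m} _ lp = roots (factor-theorem 0∈ lp)
            where
            roots : Factor m lead 0# poly → ⊥
            roots (factor {quotient = k} lk _ eq) =
              -- The polynomial is `poly² - c₀²`, of degree `2(m + 1)` with leading coefficient
              -- `lead²`; all the distinct `y j` would be roots of it.
              finitely-many-roots (suc m ℕ.+ suc m)
                (Leading-+ (Leading-* lp lp) (Poly-≤ (s≤s z≤n) (Poly-const (neg-closed (*-closed c₀∈ c₀∈)))))
                (*-≉0 lead≉0 lead≉0) y y∈ y-distinct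
                (λ j → x≈y⇒x∙y⁻¹≈ε (squares j))
              where
              -- One factor `C` of `n j ≈ C C j` supplies the `c₀ * H` in front of `q j`; the other
              -- one remains inside.
              q : ℕ → Carrier
              q j = (C * fromℕ j) * ((n j + 1#) * k (y j))

              q∈ : ∀ j → Integer (q j)
              q∈ j = *-closed (*-closed C∈ (integer (+ j) refl))
                (*-closed (+-closed (n∈ j) 1∈) (Poly-closed (leading lk) (y∈ j)))

              value≈ : ∀ j → poly (y j) ≈ c₀ * (1# + H * q j)
              value≈ j = begin
                poly (y j)                                  ≈⟨ eq (y j) ⟩
                c₀ + (y j - 0#) * k (y j)
                  ≈⟨ solve 3 (λ c n k → c :+ (n :* n :+ n :- con (+ 0)) :* k := c :+ n :* ((n :+ con (+ 1)) :* k))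
                       refl c₀ (n j) (k (y j)) ⟩
                c₀ + n j * ((n j + 1#) * k (y j))           ≈⟨ +-congˡ (*-congʳ (n≈CCj j)) ⟩
                c₀ + ((C * C) * fromℕ j) * ((n j + 1#) * k (y j))
                  ≈⟨ solve 4 (λ c h i z → c :+ (((c :* h) :* (c :* h)) :* i) :* z :=
                                c :* (con (+ 1) :+ h :* (((c :* h) :* i) :* z)))
                       refl c₀ H (fromℕ j) ((n j + 1#) * k (y j)) ⟩
                c₀ * (1# + H * q j)                         ∎

              unit : ∀ j → PowerMultiple Integer-isSubring (poly (y j)) H → (1# + H * q j) ∣ 1# within Integer
              unit j (power-multiple M p∣Hᴹ) = coprime-divisor Integer-isSubring H∈ (q∈ j) M
                (∣-trans Integer-isSubring (divides c₀∈ (trans (*-comm _ _) (sym (value≈ j)))) p∣Hᴹ)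

              squares : ∀ j → poly (y j) * poly (y j) ≈ c₀ * c₀
              squares j = begin
                poly (y j) * poly (y j)                          ≈⟨ *-cong (value≈ j) (value≈ j) ⟩
                (c₀ * (1# + H * q j)) * (c₀ * (1# + H * q j))
                  ≈⟨ solve 2 (λ c u → (c :* u) :* (c :* u) := (c :* c) :* (u :* u)) refl c₀ (1# + H * q j) ⟩
                (c₀ * c₀) * ((1# + H * q j) * (1# + H * q j))
                  ≈⟨ *-congˡ (unit-square (+-closed 1∈ (*-closed H∈ (q∈ j))) (unit j (value-divides (n∈ j)))) ⟩
                (c₀ * c₀) * 1#                                   ≈⟨ *-identityʳ _ ⟩
                c₀ * c₀                                          ∎

  module PositiveCharacteristic {p} (charP : fromℕ (suc p) ≈ 0#) where
    open Polynomials K Integer-isSubring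
    open IsSubring Integer-isSubring

    -- `suc p` is any positive integer vanishing in `K`, so equal elements may receive different
    -- codes. The pigeonhole argument uses the other direction, that equal codes come from equal
    -- elements.
    integer-code : ∀ {x} → Integer x → Fin (suc p)
    integer-code (integer i _) = fromℕ< (ℤ.n%ℕd<d i (suc p))

    integer-code-injective : ∀ {x y} (x∈ : Integer x) (y∈ : Integer y) →
                             integer-code x∈ ≡ integer-code y∈ → x ≈ y
    integer-code-injective (integer i x≈i) (integer j y≈j) eq =
      trans (x≈i%p i x≈i) (trans (reflexive (≡.cong fromℕ i%p≡j%p)) (sym (x≈i%p j y≈j)))
      where
      x≈i%p : ∀ {x} i → x ≈ fromℤ i → x ≈ fromℕ (i ℤ.%ℕ suc p)
      x≈i%p {x} i x≈i = begin
        x                                                                ≈⟨ x≈i ⟩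
        fromℤ i                                                          ≡⟨ ≡.cong fromℤ (ℤ.a≡a%ℕn+[a/ℕn]*n i (suc p)) ⟩
        fromℤ (+ (i ℤ.%ℕ suc p) ℤ.+ (i ℤ./ℕ suc p) ℤ.* + suc p)          ≈⟨ fromℤ-+ (+ (i ℤ.%ℕ suc p)) ((i ℤ./ℕ suc p) ℤ.* + suc p) ⟩
        fromℕ (i ℤ.%ℕ suc p) + fromℤ ((i ℤ./ℕ suc p) ℤ.* + suc p)        ≈⟨ +-congˡ (fromℤ-* (i ℤ./ℕ suc p) (+ suc p)) ⟩
        fromℕ (i ℤ.%ℕ suc p) + fromℤ (i ℤ./ℕ suc p) * fromℕ (suc p)      ≈⟨ +-congˡ (*-congˡ charP) ⟩
        fromℕ (i ℤ.%ℕ suc p) + fromℤ (i ℤ./ℕ suc p) * 0#                 ≈⟨ +-congˡ (zeroʳ _) ⟩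
        fromℕ (i ℤ.%ℕ suc p) + 0#                                        ≈⟨ +-identityʳ _ ⟩
        fromℕ (i ℤ.%ℕ suc p)                                             ∎

      i%p≡j%p : i ℤ.%ℕ suc p ≡ j ℤ.%ℕ suc p
      i%p≡j%p = ≡.trans (≡.sym (Fin.toℕ-fromℕ< (ℤ.n%ℕd<d i (suc p))))
        (≡.trans (≡.cong toℕ eq) (Fin.toℕ-fromℕ< (ℤ.n%ℕd<d j (suc p))))

    poly-count : ℕ → ℕ
    poly-count zero    = 1
    poly-count (suc n) = poly-count n ℕ.* suc p

    poly-code : ∀ {n f} → Poly n f → Fin (poly-count n)
    poly-code (vanishing _)                    = Fin.zero
    poly-code (leading (leading-term pf a∈ _)) = combine (poly-code pf) (integer-code a∈)

    poly-code-injective : ∀ {n f g} (pf : Poly n f) (pg : Poly n g) → poly-code pf ≡ poly-code pg →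
                          ∀ x → f x ≈ g x
    poly-code-injective (vanishing f≈0) (vanishing g≈0) _ x = trans (f≈0 x) (sym (g≈0 x))
    poly-code-injective (leading (leading-term pf a∈ eqf)) (leading (leading-term pg b∈ eqg)) eq x =
      trans (eqf x) (trans (+-cong
          (poly-code-injective pf pg (Fin.combine-injectiveˡ (poly-code pf) _ (poly-code pg) _ eq) x)
          (*-congʳ (integer-code-injective a∈ b∈ (Fin.combine-injectiveʳ (poly-code pf) _ (poly-code pg) _ eq))))
        (sym (eqg x)))

    record ProportionalPairs (a b : ℕ → Carrier) : Set (c ⊔ ℓ) where
      constructor proportional
      field
        {i j}  : ℕ
        i<j    : i < j
        {x y}  : Carrier
        x≉0    : x ≉0
        a-prop : x * a i ≈ y * a j
        b-prop : x * b i ≈ y * b j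

    -- Up to a nonzero scale, each pair consists of the values at `d` of two polynomials of degree
    -- below the minimal one. Their coefficients come from a finite ring, so there are finitely many
    -- codes and two pairs share one.
    proportional-pairs : ∀ {d} → MinimalPolynomial Integer-isSubring d → (a b : ℕ → Carrier) →
      (∀ i → Adjoin Integer-isSubring d (a i)) → (∀ i → Adjoin Integer-isSubring d (b i)) →
      ProportionalPairs a b
    proportional-pairs {d} mp a b a∈ b∈ = collide (Fin.pigeonhole (ℕ.n<1+n _) (λ i → code (pair (toℕ i))))
      where
      open MinimalPolynomial mp
      e∈ = Leading.lead∈ leading-poly

      record ReducedPair (u v : Carrier) : Set (c ⊔ ℓ) where
        pattern
        constructor reduced-pair
        field
          {scale} : Carrier
          scale≉0 : scale ≉0
          {f g}   : Carrier → Carrier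
          polyf   : Poly degree f
          polyg   : Poly degree g
          f≈      : scale * u ≈ f d
          g≈      : scale * v ≈ g d

      code : ∀ {u v} → ReducedPair u v → Fin (poly-count degree ℕ.* poly-count degree)
      code (reduced-pair _ pf pg _ _) = combine (poly-code pf) (poly-code pg)

      -- Both entries of a pair must carry the same scale, hence the cross multiplication by powers
      -- of `lead`.
      combine-reduced : ∀ {m n u v} → Reduced Integer-isSubring mp m u → Reduced Integer-isSubring mp n v →
                        ReducedPair u v
      combine-reduced {m} {n} {u} {v} (reduced pf eqf) (reduced pg eqg) = reduced-pair
        (*-≉0 (^-≉0 n lead≉0) (^-≉0 m lead≉0))
        (Poly-scale (^-closed n e∈) pf) (Poly-scale (^-closed m e∈) pg)
        (trans (*-assoc _ _ _) (*-congˡ eqf))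
        (trans (*-congʳ (*-comm _ _)) (trans (*-assoc _ _ _) (*-congˡ eqg)))

      reduce-value : ∀ {u v} → Adjoin Integer-isSubring d u → Adjoin Integer-isSubring d v → ReducedPair u v
      reduce-value (value pf u≈) (value pg v≈) = transport (combine-reduced (reduce Integer-isSubring mp pf) (reduce Integer-isSubring mp pg))
        where
        transport : ReducedPair _ _ → ReducedPair _ _
        transport (reduced-pair s≉0 pf pg f≈ g≈) =
          reduced-pair s≉0 pf pg (trans (*-congˡ u≈) f≈) (trans (*-congˡ v≈) g≈)

      pair : ∀ i → ReducedPair (a i) (b i)
      pair i = reduce-value (a∈ i) (b∈ i)

      compare : ∀ {i j} → i < j → (u : ReducedPair (a i) (b i)) (v : ReducedPair (a j) (b j)) →
                code u ≡ code v → ProportionalPairs a b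
      compare i<j (reduced-pair s≉0 pf pg f≈ g≈) (reduced-pair _ pf′ pg′ f′≈ g′≈) eq = proportional i<j s≉0
        (trans f≈ (trans (poly-code-injective pf pf′ (Fin.combine-injectiveˡ (poly-code pf) (poly-code pg) _ _ eq) d) (sym f′≈)))
        (trans g≈ (trans (poly-code-injective pg pg′ (Fin.combine-injectiveʳ (poly-code pf) (poly-code pg) (poly-code pf′) _ eq) d) (sym g′≈)))

      collide : ∃[ i ] ∃[ j ] i Fin.< j × code (pair (toℕ i)) ≡ code (pair (toℕ j)) → ProportionalPairs a b
      collide (i , j , i<j , eq) = compare i<j (pair (toℕ i)) (pair (toℕ j)) eq

-- Saturated subgroups and maximal independent sets

module Saturation (em : ∀ ℓ → ExcludedMiddle ℓ) (A : AbelianGroup c ℓ) where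
  open AbelianGroup A
  open Algebra.Definitions.RawMonoid rawMonoid using (sum) renaming (_×_ to _×ℕ_)
  open Algebra.Properties.CommutativeMonoid.Sum commutativeMonoid using (sum-remove)
  open Algebra.Properties.Group group using (inverseˡ-unique; ⁻¹-involutive)

  infixr 8 _⋆_
  _⋆_ : ℤ → Carrier → Carrier
  _⋆_ = _·_ A

  -- Saturation says that the quotient by `H` is torsion-free.
  record IsSaturatedSubgroup (H : Pred Carrier p) : Set (c ⊔ ℓ ⊔ p) where
    field
      respects   : H Respects _≈_
      ε-closed   : H ε
      ∙-closed   : ∀ {x y} → H x → H y → H (x ∙ y)
      ⁻¹-closed  : ∀ {x} → H x → H (x ⁻¹)
      saturated  : ∀ n {x} → H (suc n ×ℕ x) → H x

    ×-closed : ∀ n {x} → H x → H (n ×ℕ x)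
    ×-closed zero    x∈ = ε-closed
    ×-closed (suc n) x∈ = ∙-closed x∈ (×-closed n x∈)

    ⋆-closed : ∀ z {x} → H x → H (z ⋆ x)
    ⋆-closed (+ n)    x∈ = ×-closed n x∈
    ⋆-closed -[1+ n ] x∈ = ⁻¹-closed (×-closed (suc n) x∈)

    sum-closed : ∀ {n} {x : Fin n → Carrier} → (∀ i → H (x i)) → H (sum x)
    sum-closed {zero}  x∈ = ε-closed
    sum-closed {suc n} x∈ = ∙-closed (x∈ Fin.zero) (sum-closed (x∈ ∘ Fin.suc))

    ⋆-saturated : ∀ z {x} → H (z ⋆ x) → z ≡ 0ℤ ⊎ H x
    ⋆-saturated (+ zero)  _ = inj₁ ≡.refl
    ⋆-saturated (+ suc n) h = inj₂ (saturated n h)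
    ⋆-saturated -[1+ n ]  h = inj₂ (saturated n (respects (⁻¹-involutive _) (⁻¹-closed h)))

  -- An element outside H could be added to S without destroying its independence.
  maximal⊆saturated⇒everything : ∀ {S} {H : Pred Carrier p} → IsMaximalIndependent A S →
    IsSaturatedSubgroup H → S ⊆ H → ∀ x → H x
  maximal⊆saturated⇒everything {p = p} {S} {H} maxS satH S⊆H x with em p {H x}
  ... | yes x∈H = x∈H
  ... | no x∉H  = S⊆H (maximal T T-respects T-independent inj₁ (inj₂ refl))
    where
    open IsMaximalIndependent maxS
    open IsSaturatedSubgroup satH hiding (respects)
    module H = IsSaturatedSubgroup satH

    T : Pred Carrier (c ⊔ ℓ)
    T y = y ∈ S ⊎ y ≈ x

    T-respects : T Respects _≈_
    T-respects y≈z (inj₁ y∈S) = inj₁ (respects y≈z y∈S)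
    T-respects y≈z (inj₂ y≈x) = inj₂ (trans (sym y≈z) y≈x)

    fromS : ∀ {y} → T y → ¬ y ≈ x → S y
    fromS (inj₁ y∈S) _   = y∈S
    fromS (inj₂ y≈x) y≉x = ⊥-elim (y≉x y≈x)

    T-independent : LinearlyIndependent A T
    T-independent n t t∈T t-inj z sum≈ε with em ℓ {∃[ i ] t i ≈ x}
    ... | no ∄x = independent n t (λ i → fromS (t∈T i) (λ ti≈x → ∄x (i , ti≈x))) t-inj z sum≈ε
    T-independent (suc n) t t∈T t-inj z sum≈ε | yes (i₀ , ti₀≈x) = all-zero
      where
      rest : Fin n → Fin (suc n)
      rest = punchIn i₀

      rest∈S : ∀ j → S (t (rest j))
      rest∈S j = fromS (t∈T (rest j)) λ tj≈x →
        Fin.punchInᵢ≢i i₀ j (t-inj (trans tj≈x (sym ti₀≈x)))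

      split : (z i₀ ⋆ t i₀) ∙ sum (λ j → z (rest j) ⋆ t (rest j)) ≈ ε
      split = trans (sym (sum-remove (λ i → z i ⋆ t i))) sum≈ε

      -- The relation writes the `z i₀`-th power of `x` as the inverse of a product of elements of
      -- `H`; were `z i₀` nonzero, saturation would put `x` into `H`.
      zi₀≡0 : z i₀ ≡ 0ℤ
      zi₀≡0 = [ (λ z≡0 → z≡0) , (λ ti₀∈H → ⊥-elim (x∉H (H.respects ti₀≈x ti₀∈H))) ]′
        (⋆-saturated (z i₀) (H.respects (sym (inverseˡ-unique _ _ split))
          (⁻¹-closed (sum-closed (λ j → ⋆-closed (z (rest j)) (S⊆H (rest∈S j)))))))

      rest≡0 : ∀ j → z (rest j) ≡ 0ℤ
      rest≡0 = independent n (t ∘ rest) rest∈S (Fin.punchIn-injective i₀ _ _ ∘ t-inj) (z ∘ rest)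
        (trans (sym (identityˡ _))
          (trans (∙-congʳ (sym (≡.subst (λ k → k ⋆ t i₀ ≈ ε) (≡.sym zi₀≡0) refl))) split))

      all-zero : ∀ i → z i ≡ 0ℤ
      all-zero i with i₀ Fin.≟ i
      ... | yes ≡.refl = zi₀≡0
      ... | no i₀≢i    = ≡.subst (λ k → z k ≡ 0ℤ) (Fin.punchIn-punchOut i₀≢i) (rest≡0 (punchOut i₀≢i))

-- Coordinates in a quadratic extension

module QuadraticExtension
  (em : ∀ ℓ → ExcludedMiddle ℓ) {k ℓk l ℓl} (K : CommutativeRing k ℓk) (L : CommutativeRing l ℓl)
  (isFieldK : IsField K) (isFieldL : IsField L)
  {ι : CommutativeRing.Carrier K → CommutativeRing.Carrier L}
  (ι-hom : IsRingHomomorphism (CommutativeRing.rawRing K) (CommutativeRing.rawRing L) ι)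
  where
  private
    module K where
      open CommutativeRing K public
      open Algebra.Properties.Ring ring public using (x∙y⁻¹≈ε⇒x≈y; x≈y⇒x∙y⁻¹≈ε; -0#≈0#)
      open Algebra.Properties.Semiring.Exp semiring public
      open IntegerCoefficients K public using (fromℕ)
      open IntegerCoefficients.Solver K public using (solve; _:=_; con; _:+_; _:*_; _:-_; :-_)
      open Subrings K public
      open Relation.Binary.Reasoning.Setoid setoid public
    module L where
      open CommutativeRing L public
      open Algebra.Properties.Ring ring public
      open Algebra.Properties.Semiring.Exp semiring public
      open Algebra.Properties.CommutativeSemiring.Exp commutativeSemiring public using (^-distrib-*)
      open Adjunction em L isFieldL public using (_≉0; invert; *-cancel-zero; *-≉0; ^-≉0)
      open IntegerCoefficients.Solver L public using (solve; _:=_; con; _:+_; _:*_; _:-_; :-_)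
      open Subrings L public
      open Relation.Binary.Reasoning.Setoid setoid public
    module KF = Adjunction em K isFieldK
    open KF using (_≉0; invert)
    open L using (_≈_; _+_; _*_; _-_; -_; 0#; 1#; _^_; solve; _:=_; con; _:+_; _:*_; _:-_; :-_;
                  refl; sym; trans; +-cong; +-congˡ; +-congʳ; *-cong; *-congˡ; *-congʳ; begin_; step-≈-⟩; step-≈-⟨; _∎)
    open IsRingHomomorphism ι-hom using () renaming
      (+-homo to ι-+; *-homo to ι-*; -‿homo to ι-neg; 0#-homo to ι-0; 1#-homo to ι-1; ⟦⟧-cong to ι-cong)

  ι-≉0 : ∀ {x} → x ≉0 → ι x L.≉0
  ι-≉0 {x} x≉0 ιx≈0 = go (invert x≉0)
    where
    go : ¬ (∃[ y ] x K.* y K.≈ K.1#)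
    go (y , xy≈1) = IsField.1≉0 isFieldL (begin
      1#          ≈⟨ ι-1 ⟨
      ι K.1#      ≈⟨ ι-cong xy≈1 ⟨
      ι (x K.* y) ≈⟨ ι-* x y ⟩
      ι x * ι y   ≈⟨ *-congʳ ιx≈0 ⟩
      0# * ι y    ≈⟨ L.zeroˡ _ ⟩
      0#          ∎)

  ι-reflects-0 : ∀ {x} → ι x ≈ 0# → x K.≈ K.0#
  ι-reflects-0 {x} ιx≈0 with em _ {x K.≈ K.0#}
  ... | yes x≈0 = x≈0
  ... | no x≉0  = ⊥-elim (ι-≉0 x≉0 ιx≈0)

  ι-minus : ∀ x y → ι (x K.- y) ≈ ι x - ι y
  ι-minus x y = trans (ι-+ x (K.- y)) (+-congˡ (ι-neg y))

  ι-injective : ∀ {x y} → ι x ≈ ι y → x K.≈ y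
  ι-injective {x} {y} eq = K.x∙y⁻¹≈ε⇒x≈y x y (ι-reflects-0 (trans (ι-minus x y) (L.x≈y⇒x∙y⁻¹≈ε eq)))

  Rational : L.Carrier → Set _
  Rational y = ∃[ c ] y ≈ ι c

  rational-quotient : ∀ {a b y} → b ≉0 → ι b * y ≈ ι a → Rational y
  rational-quotient {a} {b} {y} b≉0 by≈a = go (invert b≉0)
    where
    go : ∃[ b′ ] b K.* b′ K.≈ K.1# → Rational y
    go (b′ , bb′≈1) = b′ K.* a , (begin
      y                     ≈⟨ L.*-identityˡ y ⟨
      1# * y                ≈⟨ *-congʳ (trans (sym ι-1) (trans (ι-cong (K.sym bb′≈1)) (ι-* b b′))) ⟩
      (ι b * ι b′) * y      ≈⟨ solve 3 (λ b c y → (b :* c) :* y := c :* (b :* y)) refl (ι b) (ι b′) y ⟩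
      ι b′ * (ι b * y)      ≈⟨ *-congˡ by≈a ⟩
      ι b′ * ι a            ≈⟨ ι-* b′ a ⟨
      ι (b′ K.* a)          ∎)

  Coordinates : L.Carrier → L.Carrier → Set _
  Coordinates α y = ∃[ a ] ∃[ b ] y ≈ ι a + ι b * α

  ι-minor : ∀ a b c d → ι (a K.* b K.- c K.* d) ≈ ι a * ι b - ι c * ι d
  ι-minor a b c d = trans (ι-minus _ _) (+-cong (ι-* a b) (L.-‿cong (ι-* c d)))

  -- Cramer's rule for the coordinates of 1, α and y in the given basis.
  irrational-spans : HasDegree K L ι 2 → ∀ {α} → ¬ Rational α → ∀ y → Coordinates α y
  irrational-spans deg {α} α∉K y = go (spanning 1#) (spanning α) (spanning y)
    where
    open HasDegree deg
    e₀ = basis Fin.zero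
    e₁ = basis (Fin.suc Fin.zero)

    Spanned : L.Carrier → Set _
    Spanned x = Σ[ c ∈ (Fin 2 → K.Carrier) ] x ≈ ι (c Fin.zero) * e₀ + (ι (c (Fin.suc Fin.zero)) * e₁ + 0#)

    go : Spanned 1# → Spanned α → Spanned y → Coordinates α y
    go (u , 1≈) (a , α≈) (v , y≈) = finish (invert det≉0)
      where
      u₀ = u Fin.zero
      u₁ = u (Fin.suc Fin.zero)
      a₀ = a Fin.zero
      a₁ = a (Fin.suc Fin.zero)
      v₀ = v Fin.zero
      v₁ = v (Fin.suc Fin.zero)
      det = u₀ K.* a₁ K.- u₁ K.* a₀

      -- If the determinant vanishes, the coordinates of `1#` and `α` are proportional, so either
      -- `1#` is zero or `α` is rational.
      det≉0 : det ≉0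
      det≉0 det≈0 with em _ {u₀ K.≈ K.0#} | em _ {u₁ K.≈ K.0#}
      ... | yes u₀≈0 | yes u₁≈0 = IsField.1≉0 isFieldL (begin
        1#                               ≈⟨ 1≈ ⟩
        ι u₀ * e₀ + (ι u₁ * e₁ + 0#)     ≈⟨ +-cong (*-congʳ (trans (ι-cong u₀≈0) ι-0)) (+-congʳ (*-congʳ (trans (ι-cong u₁≈0) ι-0))) ⟩
        0# * e₀ + (0# * e₁ + 0#)
          ≈⟨ solve 2 (λ x y → con (+ 0) :* x :+ (con (+ 0) :* y :+ con (+ 0)) := con (+ 0)) refl e₀ e₁ ⟩
        0#                               ∎)
      ... | no u₀≉0 | _ = α∉K (rational-quotient u₀≉0 (begin
        ι u₀ * α                                                     ≈⟨ *-congˡ α≈ ⟩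
        ι u₀ * (ι a₀ * e₀ + (ι a₁ * e₁ + 0#))
          ≈⟨ solve 6 (λ u₀ u₁ a₀ a₁ e₀ e₁ → u₀ :* (a₀ :* e₀ :+ (a₁ :* e₁ :+ con (+ 0))) :=
                        a₀ :* (u₀ :* e₀ :+ (u₁ :* e₁ :+ con (+ 0))) :+ (u₀ :* a₁ :- u₁ :* a₀) :* e₁)
               refl (ι u₀) (ι u₁) (ι a₀) (ι a₁) e₀ e₁ ⟩
        ι a₀ * (ι u₀ * e₀ + (ι u₁ * e₁ + 0#)) + (ι u₀ * ι a₁ - ι u₁ * ι a₀) * e₁
          ≈⟨ +-cong (*-congˡ (sym 1≈)) (*-congʳ (trans (sym (ι-minor u₀ a₁ u₁ a₀)) (trans (ι-cong det≈0) ι-0))) ⟩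
        ι a₀ * 1# + 0# * e₁
          ≈⟨ solve 2 (λ a e → a :* con (+ 1) :+ con (+ 0) :* e := a) refl (ι a₀) e₁ ⟩
        ι a₀                                                         ∎))
      ... | _ | no u₁≉0 = α∉K (rational-quotient u₁≉0 (begin
        ι u₁ * α                                                     ≈⟨ *-congˡ α≈ ⟩
        ι u₁ * (ι a₀ * e₀ + (ι a₁ * e₁ + 0#))
          ≈⟨ solve 6 (λ u₀ u₁ a₀ a₁ e₀ e₁ → u₁ :* (a₀ :* e₀ :+ (a₁ :* e₁ :+ con (+ 0))) :=
                        a₁ :* (u₀ :* e₀ :+ (u₁ :* e₁ :+ con (+ 0))) :- (u₀ :* a₁ :- u₁ :* a₀) :* e₀)
               refl (ι u₀) (ι u₁) (ι a₀) (ι a₁) e₀ e₁ ⟩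
        ι a₁ * (ι u₀ * e₀ + (ι u₁ * e₁ + 0#)) - (ι u₀ * ι a₁ - ι u₁ * ι a₀) * e₀
          ≈⟨ +-cong (*-congˡ (sym 1≈)) (L.-‿cong (*-congʳ (trans (sym (ι-minor u₀ a₁ u₁ a₀)) (trans (ι-cong det≈0) ι-0)))) ⟩
        ι a₁ * 1# - 0# * e₀
          ≈⟨ solve 2 (λ a e → a :* con (+ 1) :- con (+ 0) :* e := a) refl (ι a₁) e₀ ⟩
        ι a₁                                                         ∎))

      finish : ∃[ r ] det K.* r K.≈ K.1# → Coordinates α y
      finish (r , det*r≈1) = r K.* b₀ , r K.* b₁ , (begin
        y                                ≈⟨ L.*-identityˡ y ⟨
        1# * y                           ≈⟨ *-congʳ (trans (sym ι-1) (trans (ι-cong (K.sym det*r≈1)) (ι-* det r))) ⟩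
        (ι det * ι r) * y                ≈⟨ solve 3 (λ d r y → (d :* r) :* y := r :* (d :* y)) refl (ι det) (ι r) y ⟩
        ι r * (ι det * y)                ≈⟨ *-congˡ det-y ⟩
        ι r * (ι b₀ + ι b₁ * α)            ≈⟨ solve 4 (λ r b₀ b₁ α → r :* (b₀ :+ b₁ :* α) := r :* b₀ :+ (r :* b₁) :* α) refl (ι r) (ι b₀) (ι b₁) α ⟩
        ι r * ι b₀ + (ι r * ι b₁) * α      ≈⟨ +-cong (ι-* r b₀) (*-congʳ (ι-* r b₁)) ⟨
        ι (r K.* b₀) + ι (r K.* b₁) * α    ∎)
        where
        b₀ = v₀ K.* a₁ K.- v₁ K.* a₀
        b₁ = v₁ K.* u₀ K.- v₀ K.* u₁

        det-y : ι det * y ≈ ι b₀ + ι b₁ * α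
        det-y = begin
          ι det * y
            ≈⟨ *-cong (ι-minor u₀ a₁ u₁ a₀) y≈ ⟩
          (ι u₀ * ι a₁ - ι u₁ * ι a₀) * (ι v₀ * e₀ + (ι v₁ * e₁ + 0#))
            ≈⟨ solve 8 (λ u₀ u₁ a₀ a₁ v₀ v₁ e₀ e₁ →
                 (u₀ :* a₁ :- u₁ :* a₀) :* (v₀ :* e₀ :+ (v₁ :* e₁ :+ con (+ 0))) :=
                 (v₀ :* a₁ :- v₁ :* a₀) :* (u₀ :* e₀ :+ (u₁ :* e₁ :+ con (+ 0))) :+
                 (v₁ :* u₀ :- v₀ :* u₁) :* (a₀ :* e₀ :+ (a₁ :* e₁ :+ con (+ 0))))
                 refl (ι u₀) (ι u₁) (ι a₀) (ι a₁) (ι v₀) (ι v₁) e₀ e₁ ⟩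
          (ι v₀ * ι a₁ - ι v₁ * ι a₀) * (ι u₀ * e₀ + (ι u₁ * e₁ + 0#)) +
          (ι v₁ * ι u₀ - ι v₀ * ι u₁) * (ι a₀ * e₀ + (ι a₁ * e₁ + 0#))
            ≈⟨ +-cong (*-cong (ι-minor v₀ a₁ v₁ a₀) 1≈) (*-cong (ι-minor v₁ u₀ v₀ u₁) α≈) ⟨
          ι b₀ * 1# + ι b₁ * α
            ≈⟨ +-congʳ (L.*-identityʳ _) ⟩
          ι b₀ + ι b₁ * α ∎

  ι-^ : ∀ x n → ι (x K.^ n) ≈ ι x ^ n
  ι-^ x zero    = ι-1
  ι-^ x (suc n) = trans (ι-* x (x K.^ n)) (*-congˡ (ι-^ x n))

  A : AbelianGroup _ _
  A = unitsQuotient K L ι-hom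

  private
    module A = AbelianGroup A
    open Algebra.Definitions.RawMonoid A.rawMonoid using () renaming (_×_ to _×ℕ_)
    module S = Saturation em A

  proj₁-× : ∀ n u → proj₁ (n ×ℕ u) ≡ proj₁ u ^ n
  proj₁-× zero    u = ≡.refl
  proj₁-× (suc n) u = ≡.cong (proj₁ u *_) (proj₁-× n u)

  -- Conjugation, norms and integral ratios for a generator of trace 1

  module Conjugation {β : L.Carrier} {d : K.Carrier} (β∉K : ¬ Rational β) (β*β≈ : β * β ≈ β + ι d)
                     (coordinates : ∀ y → Coordinates β y) where

    φ : K.Carrier → K.Carrier → L.Carrier
    φ a b = ι a + ι b * β

    re im : L.Carrier → K.Carrier
    re y = proj₁ (coordinates y)
    im y = proj₁ (proj₂ (coordinates y))

    ≈φ : ∀ y → y ≈ φ (re y) (im y)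
    ≈φ y = proj₂ (proj₂ (coordinates y))

    φ-cong : ∀ {a b a′ b′} → a K.≈ a′ → b K.≈ b′ → φ a b ≈ φ a′ b′
    φ-cong a≈a′ b≈b′ = +-cong (ι-cong a≈a′) (*-congʳ (ι-cong b≈b′))

    φ-minus : ∀ a b a′ b′ → φ a b - φ a′ b′ ≈ φ (a K.- a′) (b K.- b′)
    φ-minus a b a′ b′ = trans
      (solve 5 (λ a b c d x → (a :+ b :* x) :- (c :+ d :* x) := (a :- c) :+ (b :- d) :* x) refl (ι a) (ι b) (ι a′) (ι b′) β)
      (sym (+-cong (ι-minus a a′) (*-congʳ (ι-minus b b′))))

    -- With `b` nonzero, `β` would be `- a / b`.
    φ≈0 : ∀ {a b} → φ a b ≈ 0# → a K.≈ K.0# × b K.≈ K.0#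
    φ≈0 {a} {b} φ≈0 = ι-reflects-0 ιa≈0 , b≈0
      where
      b≈0 : b K.≈ K.0#
      b≈0 with em _ {b K.≈ K.0#}
      ... | yes eq = eq
      ... | no b≉0 = ⊥-elim (β∉K (rational-quotient b≉0 (begin
        ι b * β                ≈⟨ solve 2 (λ a y → y := (:- a) :+ (a :+ y)) refl (ι a) (ι b * β) ⟩
        - ι a + φ a b          ≈⟨ +-cong (sym (ι-neg a)) φ≈0 ⟩
        ι (K.- a) + 0#         ≈⟨ L.+-identityʳ _ ⟩
        ι (K.- a)              ∎)))

      ιa≈0 : ι a ≈ 0#
      ιa≈0 = begin
        ι a                    ≈⟨ solve 2 (λ a x → a := a :+ con (+ 0) :* x) refl (ι a) β ⟩
        ι a + 0# * β           ≈⟨ +-congˡ (*-congʳ (trans (ι-cong b≈0) ι-0)) ⟨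
        φ a b                  ≈⟨ φ≈0 ⟩
        0#                     ∎

    φ-injective : ∀ {a b a′ b′} → φ a b ≈ φ a′ b′ → a K.≈ a′ × b K.≈ b′
    φ-injective {a} {b} {a′} {b′} eq =
      let a-a′≈0 , b-b′≈0 = φ≈0 (trans (sym (φ-minus a b a′ b′)) (L.x≈y⇒x∙y⁻¹≈ε eq))
      in K.x∙y⁻¹≈ε⇒x≈y a a′ a-a′≈0 , K.x∙y⁻¹≈ε⇒x≈y b b′ b-b′≈0

    φ-+ : ∀ a b a′ b′ → φ a b + φ a′ b′ ≈ φ (a K.+ a′) (b K.+ b′)
    φ-+ a b a′ b′ = trans
      (solve 5 (λ a b c d x → (a :+ b :* x) :+ (c :+ d :* x) := (a :+ c) :+ (b :+ d) :* x) refl (ι a) (ι b) (ι a′) (ι b′) β)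
      (sym (+-cong (ι-+ a a′) (*-congʳ (ι-+ b b′))))

    mul-re mul-im : (a b a′ b′ : K.Carrier) → K.Carrier
    mul-re a b a′ b′ = a K.* a′ K.+ d K.* (b K.* b′)
    mul-im a b a′ b′ = a K.* b′ K.+ (b K.* a′ K.+ b K.* b′)

    φ-* : ∀ a b a′ b′ → φ a b * φ a′ b′ ≈ φ (mul-re a b a′ b′) (mul-im a b a′ b′)
    φ-* a b a′ b′ = begin
      φ a b * φ a′ b′
        ≈⟨ solve 5 (λ a b a′ b′ x → (a :+ b :* x) :* (a′ :+ b′ :* x) :=
             (a :* a′ :+ (b :* b′) :* (x :* x)) :+ (a :* b′ :+ b :* a′) :* x) refl (ι a) (ι b) (ι a′) (ι b′) β ⟩
      (ι a * ι a′ + (ι b * ι b′) * (β * β)) + (ι a * ι b′ + ι b * ι a′) * β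
        ≈⟨ +-congʳ (+-congˡ (*-congˡ β*β≈)) ⟩
      (ι a * ι a′ + (ι b * ι b′) * (β + ι d)) + (ι a * ι b′ + ι b * ι a′) * β
        ≈⟨ solve 6 (λ a b a′ b′ d x →
             (a :* a′ :+ (b :* b′) :* (x :+ d)) :+ (a :* b′ :+ b :* a′) :* x :=
             (a :* a′ :+ d :* (b :* b′)) :+ (a :* b′ :+ (b :* a′ :+ b :* b′)) :* x)
             refl (ι a) (ι b) (ι a′) (ι b′) (ι d) β ⟩
      (ι a * ι a′ + ι d * (ι b * ι b′)) + (ι a * ι b′ + (ι b * ι a′ + ι b * ι b′)) * β
        ≈⟨ +-cong
             (trans (ι-+ _ _) (+-cong (ι-* a a′) (trans (ι-* d _) (*-congˡ (ι-* b b′)))))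
             (*-congʳ (trans (ι-+ _ _) (+-cong (ι-* a b′) (trans (ι-+ _ _) (+-cong (ι-* b a′) (ι-* b b′)))))) ⟨
      φ (mul-re a b a′ b′) (mul-im a b a′ b′) ∎

    ι≈φ : ∀ a → ι a ≈ φ a K.0#
    ι≈φ a = trans (solve 2 (λ a x → a := a :+ con (+ 0) :* x) refl (ι a) β) (+-congˡ (*-congʳ (sym ι-0)))

    -- The second root of `x² = x + d` is `1 - β`, so `a + b β` is sent to `(a + b) - b β`.
    conj : L.Carrier → L.Carrier
    conj y = φ (re y K.+ im y) (K.- im y)

    conj-φ : ∀ {y a b} → y ≈ φ a b → conj y ≈ φ (a K.+ b) (K.- b)
    conj-φ {y} y≈ = let re≈ , im≈ = φ-injective (trans (sym (≈φ y)) y≈)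
                    in φ-cong (K.+-cong re≈ im≈) (K.-‿cong im≈)

    conj-cong : ∀ {x y} → x ≈ y → conj x ≈ conj y
    conj-cong {x} {y} x≈y = conj-φ (trans x≈y (≈φ y))

    conj-* : ∀ x y → conj (x * y) ≈ conj x * conj y
    conj-* x y = trans
      (conj-φ (trans (*-cong (≈φ x) (≈φ y)) (φ-* (re x) (im x) (re y) (im y))))
      (trans
        (φ-cong
          (K.solve 5 (λ a b a′ b′ d →
             (a K.:* a′ K.:+ d K.:* (b K.:* b′)) K.:+ (a K.:* b′ K.:+ (b K.:* a′ K.:+ b K.:* b′)) K.:=
             (a K.:+ b) K.:* (a′ K.:+ b′) K.:+ d K.:* ((K.:- b) K.:* (K.:- b′)))
             K.refl (re x) (im x) (re y) (im y) d)
          (K.solve 4 (λ a b a′ b′ →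
             K.:- (a K.:* b′ K.:+ (b K.:* a′ K.:+ b K.:* b′)) K.:=
             (a K.:+ b) K.:* (K.:- b′) K.:+ ((K.:- b) K.:* (a′ K.:+ b′) K.:+ (K.:- b) K.:* (K.:- b′)))
             K.refl (re x) (im x) (re y) (im y)))
        (sym (φ-* (re x K.+ im x) (K.- im x) (re y K.+ im y) (K.- im y))))

    conj-ι : ∀ a → conj (ι a) ≈ ι a
    conj-ι a = trans (conj-φ (ι≈φ a))
      (trans (φ-cong (K.+-identityʳ a) K.-0#≈0#) (sym (ι≈φ a)))

    conj-1 : conj 1# ≈ 1#
    conj-1 = trans (conj-cong (sym ι-1)) (trans (conj-ι K.1#) ι-1)

    conj-^ : ∀ x n → conj (x ^ n) ≈ conj x ^ n
    conj-^ x zero    = conj-1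
    conj-^ x (suc n) = trans (conj-* x (x ^ n)) (*-congˡ (conj-^ x n))

    conj-involutive : ∀ x → conj (conj x) ≈ x
    conj-involutive x = trans (conj-φ refl) (trans
      (φ-cong (K.solve 2 (λ a b → (a K.:+ b) K.:+ (K.:- b) K.:= a) K.refl (re x) (im x))
              (K.solve 1 (λ b → K.:- (K.:- b) K.:= b) K.refl (im x)))
      (sym (≈φ x)))

    norm : K.Carrier → K.Carrier → K.Carrier
    norm a b = a K.* a K.+ a K.* b K.- d K.* (b K.* b)

    y*conj≈norm : ∀ {y a b} → y ≈ φ a b → y * conj y ≈ ι (norm a b)
    y*conj≈norm {y} {a} {b} y≈ = begin
      y * conj y
        ≈⟨ *-cong y≈ (conj-φ y≈) ⟩
      φ a b * φ (a K.+ b) (K.- b)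
        ≈⟨ φ-* a b (a K.+ b) (K.- b) ⟩
      φ (mul-re a b (a K.+ b) (K.- b)) (mul-im a b (a K.+ b) (K.- b))
        ≈⟨ φ-cong
             (K.solve 3 (λ a b d → a K.:* (a K.:+ b) K.:+ d K.:* (b K.:* (K.:- b)) K.:=
                                   a K.:* a K.:+ a K.:* b K.:- d K.:* (b K.:* b)) K.refl a b d)
             (K.solve 2 (λ a b → a K.:* (K.:- b) K.:+ (b K.:* (a K.:+ b) K.:+ b K.:* (K.:- b)) K.:= K.con (+ 0)) K.refl a b) ⟩
      φ (norm a b) K.0#
        ≈⟨ ι≈φ (norm a b) ⟨
      ι (norm a b) ∎

    -- With `d` zero, `β` would be a root of `x² - x`, that is 0 or 1.
    d≉0 : d ≉0
    d≉0 d≈0 = L.*-≉0 β≉0 β-1≉0 (begin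
      β * (β - 1#)       ≈⟨ solve 1 (λ x → x :* (x :- con (+ 1)) := x :* x :- x) refl β ⟩
      β * β - β          ≈⟨ +-congʳ (trans β*β≈ (+-congˡ (trans (ι-cong d≈0) ι-0))) ⟩
      (β + 0#) - β       ≈⟨ solve 1 (λ x → (x :+ con (+ 0)) :- x := con (+ 0)) refl β ⟩
      0#                 ∎)
      where
      β≉0 : β L.≉0
      β≉0 β≈0 = β∉K (K.0# , trans β≈0 (sym ι-0))
      β-1≉0 : β - 1# L.≉0
      β-1≉0 eq = β∉K (K.1# , trans (L.x∙y⁻¹≈ε⇒x≈y β 1# eq) (sym ι-1))

    two : K.Carrier
    two = K.1# K.+ K.1#

    -- `2β - 1`, the difference of `β` and its conjugate; its square is the discriminant of
    -- `x² - x - d`.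
    δ : L.Carrier
    δ = φ (K.- K.1#) two

    disc : K.Carrier
    disc = K.1# K.+ two K.* (two K.* d)

    δ*δ≈disc : δ * δ ≈ ι disc
    δ*δ≈disc = trans (φ-* _ _ _ _) (trans
      (φ-cong
        (K.solve 1 (λ d → let 1′ = K.con (+ 1) ; 2′ = 1′ K.:+ 1′ in
           (K.:- 1′) K.:* (K.:- 1′) K.:+ d K.:* (2′ K.:* 2′) K.:= 1′ K.:+ 2′ K.:* (2′ K.:* d)) K.refl d)
        (K.solve 0 (let 1′ = K.con (+ 1) ; 2′ = 1′ K.:+ 1′ in
           (K.:- 1′) K.:* 2′ K.:+ (2′ K.:* (K.:- 1′) K.:+ 2′ K.:* 2′) K.:= K.con (+ 0)) K.refl))
      (sym (ι≈φ disc)))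

    -- The first coordinate of `δ` is `-1`, which is nonzero in every characteristic, including 2.
    disc≉0 : disc ≉0
    disc≉0 disc≈0 = L.*-≉0 δ≉0 δ≉0 (trans δ*δ≈disc (trans (ι-cong disc≈0) ι-0))
      where
      δ≉0 : δ L.≉0
      δ≉0 δ≈0 = KF.neg-≉0 (IsField.1≉0 isFieldK) (proj₁ (φ≈0 δ≈0))

    module _ {p} {R : Pred K.Carrier p} (sub : K.IsSubring R) where
      open K.IsSubring sub

      -- R[β] = R + R β
      record Extended (y : L.Carrier) : Set (k ⊔ ℓk ⊔ ℓl ⊔ p) where
        constructor extended
        field
          {real imag} : K.Carrier
          real∈ : R real
          imag∈ : R imag
          equation : y ≈ φ real imag

      ι-Extended : ∀ {a} → R a → Extended (ι a)
      ι-Extended a∈ = extended a∈ 0∈ (ι≈φ _)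

      Extended-isSubring : R d → L.IsSubring Extended
      Extended-isSubring d∈ = record
        { respects   = λ { x≈y (extended a∈ b∈ eq) → extended a∈ b∈ (trans (sym x≈y) eq) }
        ; 0∈         = extended 0∈ 0∈ (trans (sym ι-0) (ι≈φ K.0#))
        ; 1∈         = extended 1∈ 0∈ (trans (sym ι-1) (ι≈φ K.1#))
        ; +-closed   = λ { (extended a∈ b∈ eq) (extended a′∈ b′∈ eq′) →
            extended (+-closed a∈ a′∈) (+-closed b∈ b′∈) (trans (+-cong eq eq′) (φ-+ _ _ _ _)) }
        ; *-closed   = λ { (extended a∈ b∈ eq) (extended a′∈ b′∈ eq′) →
            extended (+-closed (*-closed a∈ a′∈) (*-closed d∈ (*-closed b∈ b′∈)))
                     (+-closed (*-closed a∈ b′∈) (+-closed (*-closed b∈ a′∈) (*-closed b∈ b′∈)))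
                     (trans (*-cong eq eq′) (φ-* _ _ _ _)) }
        ; neg-closed = λ { (extended {a} {b} a∈ b∈ eq) → extended (neg-closed a∈) (neg-closed b∈)
            (trans (L.-‿cong eq) (trans (solve 3 (λ a b x → :- (a :+ b :* x) := :- a :+ (:- b) :* x) refl (ι a) (ι b) β)
              (sym (+-cong (ι-neg a) (*-congʳ (ι-neg b)))))) }
        }

      Extended-conj : ∀ {y} → Extended y → Extended (conj y)
      Extended-conj (extended a∈ b∈ eq) = extended (+-closed a∈ b∈) (neg-closed b∈) (conj-φ eq)

      re-im∈⇒Extended : ∀ y → R (re y) → R (im y) → Extended y
      re-im∈⇒Extended y re∈ im∈ = extended re∈ im∈ (≈φ y)

    module _ {p} {R : Pred K.Carrier p} (sub : K.IsSubring R) (d∈ : R d) where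
      private
        B = Extended sub
        isB = Extended-isSubring sub d∈
        module R = K.IsSubring sub
        module B = L.IsSubring isB

      -- Some power of y / conj y lies in R[β]; this property ignores factors from K.
      record IntegralRatio (y : L.Carrier) : Set (k ⊔ ℓk ⊔ l ⊔ ℓl ⊔ p) where
        constructor ratio
        field
          exponent-1 : ℕ
          {quotient} : L.Carrier
          quotient∈  : B quotient
          equation   : y ^ suc exponent-1 ≈ conj y ^ suc exponent-1 * quotient

      IntegralRatio-scale : ∀ {x y c} → y ≈ ι c * x → IntegralRatio x → IntegralRatio y
      IntegralRatio-scale {x} {y} {c} y≈cx (ratio m {w} w∈ eq) = ratio m w∈ (begin
        y ^ n                          ≈⟨ L.^-congˡ n y≈cx ⟩
        (ι c * x) ^ n                  ≈⟨ L.^-distrib-* (ι c) x n ⟩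
        ι c ^ n * x ^ n                ≈⟨ *-congˡ eq ⟩
        ι c ^ n * (conj x ^ n * w)     ≈⟨ L.*-assoc _ _ _ ⟨
        (ι c ^ n * conj x ^ n) * w     ≈⟨ *-congʳ (L.^-distrib-* (ι c) (conj x) n) ⟨
        (ι c * conj x) ^ n * w         ≈⟨ *-congʳ (L.^-congˡ n (trans (*-congʳ (sym (conj-ι c))) (sym (conj-* (ι c) x)))) ⟩
        conj (ι c * x) ^ n * w         ≈⟨ *-congʳ (L.^-congˡ n (conj-cong y≈cx)) ⟨
        conj y ^ n * w                 ∎)
        where n = suc m

      raise : ∀ {x y w} m n → x ^ m ≈ y ^ m * w → x ^ (m ℕ.* n) ≈ y ^ (m ℕ.* n) * w ^ n
      raise {x} {y} {w} m n eq = begin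
        x ^ (m ℕ.* n)          ≈⟨ L.^-assocʳ x m n ⟨
        (x ^ m) ^ n            ≈⟨ L.^-congˡ n eq ⟩
        (y ^ m * w) ^ n        ≈⟨ L.^-distrib-* (y ^ m) w n ⟩
        (y ^ m) ^ n * w ^ n    ≈⟨ *-congʳ (L.^-assocʳ y m n) ⟩
        y ^ (m ℕ.* n) * w ^ n  ∎

      IntegralRatio-* : ∀ {x y} → IntegralRatio x → IntegralRatio y → IntegralRatio (x * y)
      IntegralRatio-* {x} {y} (ratio m {v} v∈ eqx) (ratio n {w} w∈ eqy) =
        -- The common exponent is the product `suc m ℕ.* suc n`; its predecessor is what gets
        -- stored.
        ratio (n ℕ.+ m ℕ.* suc n) (B.*-closed (B.^-closed (suc n) v∈) (B.^-closed (suc m) w∈)) (begin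
          (x * y) ^ N                                              ≈⟨ L.^-distrib-* x y N ⟩
          x ^ N * y ^ N                                            ≈⟨ *-cong (raise (suc m) (suc n) eqx) y-eq ⟩
          (conj x ^ N * v ^ suc n) * (conj y ^ N * w ^ suc m)
            ≈⟨ solve 4 (λ a b c e → (a :* b) :* (c :* e) := (a :* c) :* (b :* e)) refl
                 (conj x ^ N) (v ^ suc n) (conj y ^ N) (w ^ suc m) ⟩
          (conj x ^ N * conj y ^ N) * (v ^ suc n * w ^ suc m)
            ≈⟨ *-congʳ (trans (L.^-congˡ N (conj-* x y)) (L.^-distrib-* (conj x) (conj y) N)) ⟨
          conj (x * y) ^ N * (v ^ suc n * w ^ suc m)               ∎)
        where
        N = suc m ℕ.* suc n
        y-eq : y ^ N ≈ conj y ^ N * w ^ suc m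
        y-eq = ≡.subst (λ i → y ^ i ≈ conj y ^ i * w ^ suc m) (ℕ.*-comm (suc n) (suc m)) (raise (suc n) (suc m) eqy)

      -- The inverse of `x / conj x` is also its conjugate, and `R[β]` is closed under conjugation
      -- although not under inversion.
      IntegralRatio-inverse : ∀ {x y} → x * y ≈ 1# → IntegralRatio x → IntegralRatio y
      IntegralRatio-inverse {x} {y} xy≈1 (ratio m {w} w∈ eq) = ratio m (Extended-conj sub w∈) (begin
        y ^ n
          ≈⟨ L.*-identityˡ _ ⟨
        1# * y ^ n
          ≈⟨ *-congʳ (conj-powers) ⟨
        (conj x ^ n * conj y ^ n) * y ^ n
          ≈⟨ *-congʳ (*-congʳ conj-eq) ⟩
        ((x ^ n * conj w) * conj y ^ n) * y ^ n
          ≈⟨ solve 4 (λ a w b c → ((a :* w) :* b) :* c := (a :* c) :* (b :* w)) refl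
               (x ^ n) (conj w) (conj y ^ n) (y ^ n) ⟩
        (x ^ n * y ^ n) * (conj y ^ n * conj w)
          ≈⟨ *-congʳ (powers xy≈1) ⟩
        1# * (conj y ^ n * conj w)
          ≈⟨ L.*-identityˡ _ ⟩
        conj y ^ n * conj w ∎)
        where
        n = suc m

        powers : ∀ {u v} → u * v ≈ 1# → u ^ n * v ^ n ≈ 1#
        powers {u} {v} uv≈1 = trans (sym (L.^-distrib-* u v n)) (trans (L.^-congˡ n uv≈1) (L.1^n≈1 n))

        conj-powers : conj x ^ n * conj y ^ n ≈ 1#
        conj-powers = powers (trans (sym (conj-* x y)) (trans (conj-cong xy≈1) conj-1))

        conj-eq : conj x ^ n ≈ x ^ n * conj w
        conj-eq = begin
          conj x ^ n                   ≈⟨ conj-^ x n ⟨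
          conj (x ^ n)                 ≈⟨ conj-cong eq ⟩
          conj (conj x ^ n * w)        ≈⟨ conj-* (conj x ^ n) w ⟩
          conj (conj x ^ n) * conj w   ≈⟨ *-congʳ (trans (conj-^ (conj x) n) (L.^-congˡ n (conj-involutive x))) ⟩
          x ^ n * conj w               ∎

      IntegralRatio-root : ∀ {x} n → IntegralRatio (x ^ suc n) → IntegralRatio x
      IntegralRatio-root {x} n (ratio m {w} w∈ eq) = ratio (m ℕ.+ n ℕ.* suc m) w∈ (begin
        x ^ (suc n ℕ.* suc m)             ≈⟨ L.^-assocʳ x (suc n) (suc m) ⟨
        (x ^ suc n) ^ suc m               ≈⟨ eq ⟩
        conj (x ^ suc n) ^ suc m * w      ≈⟨ *-congʳ (L.^-congˡ (suc m) (conj-^ x (suc n))) ⟩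
        (conj x ^ suc n) ^ suc m * w      ≈⟨ *-congʳ (L.^-assocʳ (conj x) (suc n) (suc m)) ⟩
        conj x ^ (suc n ℕ.* suc m) * w    ∎)

      IntegralRatio-isSaturatedSubgroup : S.IsSaturatedSubgroup (IntegralRatio ∘ proj₁)
      IntegralRatio-isSaturatedSubgroup = record
        { respects  = λ { {u} {v} ((c , c′ , cc′≈1 , _) , u≈cv) → IntegralRatio-scale {c = c′} (begin
            proj₁ v                        ≈⟨ L.*-identityˡ _ ⟨
            1# * proj₁ v                   ≈⟨ *-congʳ (trans (sym (trans (ι-cong cc′≈1) ι-1)) (ι-* c′ c)) ⟩
            (ι c′ * ι c) * proj₁ v         ≈⟨ L.*-assoc _ _ _ ⟩
            ι c′ * (ι c * proj₁ v)         ≈⟨ *-congˡ u≈cv ⟨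
            ι c′ * proj₁ u                 ∎) }
        ; ε-closed  = ratio 0 B.1∈ (sym (trans (L.*-identityʳ _) (trans (L.*-identityʳ _) (trans conj-1 (sym (L.*-identityʳ _))))))
        ; ∙-closed  = IntegralRatio-*
        ; ⁻¹-closed = λ { {x , x′ , x′x≈1 , xx′≈1} → IntegralRatio-inverse xx′≈1 }
        ; saturated = λ n {u} r → IntegralRatio-root n (≡.subst IntegralRatio (proj₁-× (suc n) u) r)
        }

      -- With y = n + β the difference y − conj y = δ is a unit of R[β], so conj y, dividing
      -- a power of y, is a unit as well, and then so is the norm of y.
      norm∣1 : ∀ {n t} → R n → R t → disc K.* t K.≈ K.1# → IntegralRatio (φ n K.1#) →
               (n K.* n K.+ n K.- d) K.∣ K.1# within R
      norm∣1 {n} {t} n∈ t∈ disc*t≈1 (ratio m {w} w∈ eq) =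
        -- `1 - y δ′` equals `- (ȳ δ′)`, an associate of `ȳ`. It divides a power of `y` by the
        -- integrality of the ratio, and it is 1 modulo `y`, so it is a unit.
        descend (L.coprime-divisor isB y∈ (B.neg-closed δ′∈) (suc m)
          (L.divides (B.neg-closed (B.*-closed δ∈ (B.*-closed (B.^-closed m ȳ∈) w∈))) divisibility))
        where
        y = φ n K.1#
        ȳ = conj y
        δ′ = δ * ι t

        y∈ : B y
        y∈ = extended n∈ R.1∈ refl

        ȳ∈ : B ȳ
        ȳ∈ = Extended-conj sub y∈

        δ∈ : B δ
        δ∈ = extended (R.neg-closed R.1∈) (R.+-closed R.1∈ R.1∈) refl

        δ′∈ : B δ′
        δ′∈ = B.*-closed δ∈ (ι-Extended sub t∈)

        δδ′≈1 : δ * δ′ ≈ 1#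
        δδ′≈1 = begin
          δ * (δ * ι t)   ≈⟨ L.*-assoc _ _ _ ⟨
          (δ * δ) * ι t   ≈⟨ *-congʳ δ*δ≈disc ⟩
          ι disc * ι t    ≈⟨ ι-* disc t ⟨
          ι (disc K.* t)  ≈⟨ ι-cong disc*t≈1 ⟩
          ι K.1#          ≈⟨ ι-1 ⟩
          1#              ∎

        y≈ȳ+δ : y ≈ ȳ + δ
        y≈ȳ+δ = sym (trans (+-congʳ (conj-φ {y} {n} {K.1#} refl)) (trans (φ-+ _ _ _ _)
          (φ-cong (K.solve 1 (λ n → (n K.:+ K.con (+ 1)) K.:+ (K.:- K.con (+ 1)) K.:= n) K.refl n)
                  (K.solve 0 ((K.:- K.con (+ 1)) K.:+ (K.con (+ 1) K.:+ K.con (+ 1)) K.:= K.con (+ 1)) K.refl))))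

        unit≈ : 1# + y * (- δ′) ≈ - (ȳ * δ′)
        unit≈ = begin
          1# + y * (- δ′)                 ≈⟨ +-cong (sym δδ′≈1) (*-congʳ y≈ȳ+δ) ⟩
          δ * δ′ + (ȳ + δ) * (- δ′)       ≈⟨ solve 3 (λ z δ e → δ :* e :+ (z :+ δ) :* (:- e) := :- (z :* e)) refl ȳ δ δ′ ⟩
          - (ȳ * δ′)                      ∎

        divisibility : (1# + y * (- δ′)) * (- (δ * (ȳ ^ m * w))) ≈ y ^ suc m
        divisibility = begin
          (1# + y * (- δ′)) * (- (δ * (ȳ ^ m * w)))   ≈⟨ *-congʳ unit≈ ⟩
          - (ȳ * δ′) * (- (δ * (ȳ ^ m * w)))
            ≈⟨ solve 5 (λ z e δ p w → :- (z :* e) :* (:- (δ :* (p :* w))) := (δ :* e) :* ((z :* p) :* w))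
                 refl ȳ δ′ δ (ȳ ^ m) w ⟩
          (δ * δ′) * (ȳ ^ suc m * w)                  ≈⟨ *-cong δδ′≈1 (sym eq) ⟩
          1# * y ^ suc m                              ≈⟨ L.*-identityˡ _ ⟩
          y ^ suc m                                   ∎

        descend : (1# + y * (- δ′)) L.∣ 1# within B → (n K.* n K.+ n K.- d) K.∣ K.1# within R
        descend (L.divides {s} s∈ us≈1) = finish (B.neg-closed (B.*-closed δ′∈ s∈))
          where
          v = - (δ′ * s)

          ȳv≈1 : ȳ * v ≈ 1#
          ȳv≈1 = begin
            ȳ * (- (δ′ * s))       ≈⟨ solve 3 (λ z e s → z :* (:- (e :* s)) := :- (z :* e) :* s) refl ȳ δ′ s ⟩
            - (ȳ * δ′) * s         ≈⟨ *-congʳ unit≈ ⟨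
            (1# + y * (- δ′)) * s  ≈⟨ us≈1 ⟩
            1#                     ∎

          finish : B v → (n K.* n K.+ n K.- d) K.∣ K.1# within R
          -- Norms are multiplicative: the norm of the inverse `v` of `ȳ` lies in `R` and inverts
          -- the norm of `y`.
          finish (extended {a} {b} a∈ b∈ v≈) = K.divides
            (R.+-closed (R.+-closed (R.*-closed a∈ a∈) (R.*-closed a∈ b∈))
                        (R.neg-closed (R.*-closed d∈ (R.*-closed b∈ b∈))))
            (K.trans (K.*-congʳ
               (K.solve 2 (λ n d → n K.:* n K.:+ n K.:- d K.:=
                  n K.:* n K.:+ n K.:* K.con (+ 1) K.:- d K.:* (K.con (+ 1) K.:* K.con (+ 1))) K.refl n d))
             (ι-injective (begin
              ι (norm n K.1# K.* norm a b)            ≈⟨ ι-* _ _ ⟩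
              ι (norm n K.1#) * ι (norm a b)          ≈⟨ *-cong (y*conj≈norm {y} refl) (y*conj≈norm v≈) ⟨
              (y * ȳ) * (v * conj v)
                ≈⟨ solve 4 (λ y z v u → (y :* z) :* (v :* u) := (z :* v) :* (y :* u)) refl y ȳ v (conj v) ⟩
              (ȳ * v) * (y * conj v)                  ≈⟨ *-cong ȳv≈1 conj-ȳv≈1 ⟩
              1# * 1#                                 ≈⟨ L.*-identityˡ 1# ⟩
              1#                                      ≈⟨ ι-1 ⟨
              ι K.1#                                  ∎)))
            where
            conj-ȳv≈1 : y * conj v ≈ 1#
            conj-ȳv≈1 = begin
              y * conj v          ≈⟨ *-congʳ (conj-involutive y) ⟨
              conj ȳ * conj v     ≈⟨ conj-* ȳ v ⟨
              conj (ȳ * v)        ≈⟨ conj-cong ȳv≈1 ⟩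
              conj 1#             ≈⟨ conj-1 ⟩
              1#                  ∎

    -- Unbounded norms and infinite rank

    open PrimeRing em K isFieldK

    private
      base = KF.Adjoin-isSubring Integer-isSubring d
      ℤ[d] = KF.Adjoin Integer-isSubring d

      d∈ℤ[d] : ℤ[d] d
      d∈ℤ[d] = KF.∈-Adjoin Integer-isSubring d

    β^-Extended : ∀ i → Extended base (β ^ i)
    β^-Extended i = L.IsSubring.^-closed (Extended-isSubring base d∈ℤ[d]) i
      (extended (K.IsSubring.0∈ base) (K.IsSubring.1∈ base)
        (trans (solve 1 (λ x → x := con (+ 0) :+ con (+ 1) :* x) refl β)
               (sym (+-cong ι-0 (*-congʳ ι-1)))))

    module _ (β-nontorsion : ∀ n → ¬ Rational (β ^ suc n)) where

      -- The powers of `β` have coordinates in `ℤ[d]`. In positive characteristic two of these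
      -- coordinate pairs are proportional over `K`, which makes the quotient of the two powers
      -- rational, against nontorsion.
      algebraic⇒characteristic-zero : KF.MinimalPolynomial Integer-isSubring d → ∀ p → K.fromℕ (suc p) ≉0
      algebraic⇒characteristic-zero mp p charP = collide (proportional-pairs mp a b
          (λ i → Extended.real∈ (β^-Extended i)) (λ i → Extended.imag∈ (β^-Extended i)))
        where
        open PositiveCharacteristic {p} charP
        a b : ℕ → K.Carrier
        a i = Extended.real (β^-Extended i)
        b i = Extended.imag (β^-Extended i)

        β≉0 : β L.≉0
        β≉0 β≈0 = β∉K (K.0# , trans β≈0 (sym ι-0))

        scaled : ∀ x i → ι x * β ^ i ≈ φ (x K.* a i) (x K.* b i)
        scaled x i = trans (*-congˡ (Extended.equation (β^-Extended i)))
          (trans (solve 4 (λ x a b y → x :* (a :+ b :* y) := x :* a :+ (x :* b) :* y) refl (ι x) (ι (a i)) (ι (b i)) β)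
                 (sym (+-cong (ι-* x (a i)) (*-congʳ (ι-* x (b i))))))

        collide : ProportionalPairs a b → ⊥
        collide (proportional {i} {j} i<j {x} {y} x≉0 a-prop b-prop) = β-nontorsion m (rational-quotient y≉0 yβ^m≈x)
          where
          -- Chosen so that `suc m` is `j - i`, the shape of exponent in which nontorsion is stated.
          m = j ℕ.∸ suc i

          i+m≡j : i ℕ.+ suc m ≡ j
          i+m≡j = ≡.trans (ℕ.+-suc i m) (ℕ.m+[n∸m]≡n i<j)

          powers : ι x * β ^ i ≈ ι y * β ^ j
          powers = trans (scaled x i) (trans (φ-cong a-prop b-prop) (sym (scaled y j)))

          yβ^m≈x : ι y * β ^ suc m ≈ ι x
          yβ^m≈x = L.x∙y⁻¹≈ε⇒x≈y _ _ (L.*-cancel-zero (L.^-≉0 i β≉0) (begin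
            β ^ i * (ι y * β ^ suc m - ι x)
              ≈⟨ solve 4 (λ p y q x → p :* (y :* q :- x) := y :* (p :* q) :- x :* p) refl (β ^ i) (ι y) (β ^ suc m) (ι x) ⟩
            ι y * (β ^ i * β ^ suc m) - ι x * β ^ i
              ≈⟨ +-congʳ (*-congˡ (L.^-homo-* β i (suc m))) ⟨
            ι y * β ^ (i ℕ.+ suc m) - ι x * β ^ i
              ≈⟨ +-cong (*-congˡ (L.^-congʳ β i+m≡j)) (L.-‿cong powers) ⟩
            ι y * β ^ j - ι y * β ^ j
              ≈⟨ L.-‿inverseʳ _ ⟩
            0# ∎))

          -- `x` is nonzero, and `ι x` is a multiple of `ι y`.
          y≉0 : y ≉0
          y≉0 y≈0 = ι-≉0 x≉0 (trans (sym yβ^m≈x) (trans (*-congʳ (trans (ι-cong y≈0) ι-0)) (L.zeroˡ _)))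

      norms-unbounded : ∀ {h} → ℤ[d] h → h ≉0 →
                        ¬ (∀ {n} → ℤ[d] n → KF.PowerMultiple base (n K.* n K.+ n K.- d) h)
      norms-unbounded h∈ h≉0 norms with KF.minimalPolynomial? Integer-isSubring d
      ... | inj₂ tr = Roots.norms-not-bounded-transcendental em K isFieldK Integer-isSubring tr h∈ h≉0 norms
      ... | inj₁ mp = CharacteristicZero.norms-not-bounded-algebraic (algebraic⇒characteristic-zero mp)
                        mp d≉0 h∈ h≉0 norms

      -- Finiteness of the rank is what keeps the list of generators of `R` finite. `R` depends on
      -- the maximal set alone, so one `h` serves all `n` in `ℤ[d]` at once.
      infinite-rank : HasInfiniteRationalRank A
      infinite-rank n (T , maxT , bij) = bounded (invert disc≉0)
        where
        open Bijection bij using (to; surjective)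

        x x⁻¹ w : Fin n → L.Carrier
        x i   = proj₁ (proj₁ (to i))
        x⁻¹ i = proj₁ (proj₂ (proj₁ (to i)))
        -- `x i / conj (x i)`, since `conj` respects inverses.
        w i   = x i * conj (x⁻¹ i)

        x⁻¹x≈1 : ∀ i → x⁻¹ i * x i ≈ 1#
        x⁻¹x≈1 i = proj₁ (proj₂ (proj₂ (proj₁ (to i))))

        bounded : ¬ (∃[ t ] disc K.* t K.≈ K.1#)
        bounded (t , disc*t≈1) = contradict (KF.control-Adjoin* base gens (K.IsSubring.1∈ isR) (IsField.1≉0 isFieldK))
          where
          -- `t` inverts the discriminant; the coordinates put every `w i` into `R[β]`.
          gens : List K.Carrier
          gens = t ∷ tabulate (re ∘ w) ++ tabulate (im ∘ w)

          R = KF.Adjoin* base gens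
          isR = KF.Adjoin*-isSubring base gens

          d∈R : R d
          d∈R = KF.⊆-Adjoin* base gens d∈ℤ[d]

          gens∈ : ∀ {y} → y ∈ˡ gens → R y
          gens∈ = KF.∈-Adjoin* base {ss = gens}

          w∈ : ∀ i → Extended isR (w i)
          w∈ i = re-im∈⇒Extended isR (w i)
            (gens∈ (there (∈-++⁺ˡ (∈-tabulate⁺ i))))
            (gens∈ (there (∈-++⁺ʳ (tabulate (re ∘ w)) (∈-tabulate⁺ i))))

          x-ratio : ∀ i → IntegralRatio isR d∈R (x i)
          x-ratio i = ratio 0 (w∈ i) (begin
            x i * 1#                                ≈⟨ *-congˡ conj-1 ⟨
            x i * conj 1#                           ≈⟨ *-congˡ (conj-cong (x⁻¹x≈1 i)) ⟨
            x i * conj (x⁻¹ i * x i)                ≈⟨ *-congˡ (conj-* (x⁻¹ i) (x i)) ⟩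
            x i * (conj (x⁻¹ i) * conj (x i))
              ≈⟨ solve 3 (λ x u v → x :* (u :* v) := (v :* con (+ 1)) :* (x :* u)) refl (x i) (conj (x⁻¹ i)) (conj (x i)) ⟩
            (conj (x i) * 1#) * w i                 ∎)

          T-ratio : ∀ {u} → T u → IntegralRatio isR d∈R (proj₁ u)
          T-ratio {u} u∈T = transport (surjective (u , u∈T))
            where
            transport : ∃[ i ] (∀ {j} → j ≡ i → proj₁ (to j) A.≈ u) → IntegralRatio isR d∈R (proj₁ u)
            transport (i , xi≈u) = S.IsSaturatedSubgroup.respects
              (IntegralRatio-isSaturatedSubgroup isR d∈R) {proj₁ (to i)} {u} (xi≈u ≡.refl) (x-ratio i)

          everything : ∀ u → IntegralRatio isR d∈R (proj₁ u)
          everything = S.maximal⊆saturated⇒everything maxT (IntegralRatio-isSaturatedSubgroup isR d∈R) T-ratio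

          y-ratio : ∀ n → IntegralRatio isR d∈R (φ n K.1#)
          -- `n + β` is nonzero, hence a unit of `L`, because its second coordinate is 1.
          y-ratio n = from-unit (IsField.invertible isFieldL (φ n K.1#)
              (λ y≈0 → IsField.1≉0 isFieldK (proj₂ (φ≈0 y≈0))))
            where
            from-unit : _ → IntegralRatio isR d∈R (φ n K.1#)
            from-unit inv = everything (φ n K.1# , inv)

          contradict : ¬ KF.Control base R K.1#
          contradict (KF.control h∈ h≉0 bounds) = norms-unbounded h∈ h≉0 λ {n} n∈ →
            -- For exponent `0` the power `K.1# K.^ 0` is `K.1#` by definition, the target of
            -- `norm∣1`.
            bounds 0 (B.+-closed (B.+-closed (B.*-closed n∈ n∈) n∈) (B.neg-closed d∈ℤ[d]))
              (norm∣1 isR d∈R (KF.⊆-Adjoin* base gens n∈) (gens∈ (here ≡.refl)) disc*t≈1 (y-ratio n))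
            where module B = K.IsSubring base

  -- Normalizing the trace and the dichotomy

  -- With t the trace of α, the element α / t has trace 1.
  nontorsion⇒infinite-rank : HasDegree K L ι 2 → ∀ {α} → (∀ n → ¬ Rational (α ^ suc n)) →
                             HasInfiniteRationalRank A
  nontorsion⇒infinite-rank deg {α} α-nontorsion = normalize (spans (α * α))
    where
    α^1≈α : α ^ 1 ≈ α
    α^1≈α = L.*-identityʳ α

    spans : ∀ y → Coordinates α y
    spans = irrational-spans deg (λ (c , α≈c) → α-nontorsion 0 (c , trans α^1≈α α≈c))

    normalize : Coordinates α (α * α) → HasInfiniteRationalRank A
    normalize (s , t , α*α≈) = scale (invert t≉0)
      where
      -- With trace zero the square of `α` would be rational; the index 1 stands for the exponent 2.
      t≉0 : t ≉0
      t≉0 t≈0 = α-nontorsion 1 (s , (begin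
        α * α ^ 1          ≈⟨ *-congˡ α^1≈α ⟩
        α * α              ≈⟨ α*α≈ ⟩
        ι s + ι t * α      ≈⟨ +-congˡ (trans (*-congʳ (trans (ι-cong t≈0) ι-0)) (L.zeroˡ α)) ⟩
        ι s + 0#           ≈⟨ L.+-identityʳ _ ⟩
        ι s                ∎))

      scale : ∃[ t′ ] t K.* t′ K.≈ K.1# → HasInfiniteRationalRank A
      scale (t′ , tt′≈1) = Conjugation.infinite-rank β∉K β*β≈ coordinates β-nontorsion
        where
        β = ι t′ * α

        ιtt′≈1 : ι t * ι t′ ≈ 1#
        ιtt′≈1 = trans (sym (ι-* t t′)) (trans (ι-cong tt′≈1) ι-1)

        tβ≈α : ι t * β ≈ α
        tβ≈α = trans (sym (L.*-assoc _ _ _)) (trans (*-congʳ ιtt′≈1) (L.*-identityˡ α))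

        β-nontorsion : ∀ n → ¬ Rational (β ^ suc n)
        β-nontorsion n (c , β^≈c) = α-nontorsion n (t K.^ suc n K.* c , (begin
          α ^ suc n                     ≈⟨ L.^-congˡ (suc n) tβ≈α ⟨
          (ι t * β) ^ suc n             ≈⟨ L.^-distrib-* (ι t) β (suc n) ⟩
          ι t ^ suc n * β ^ suc n       ≈⟨ *-cong (sym (ι-^ t (suc n))) β^≈c ⟩
          ι (t K.^ suc n) * ι c         ≈⟨ ι-* _ c ⟨
          ι (t K.^ suc n K.* c)         ∎))

        β∉K : ¬ Rational β
        β∉K (c , β≈c) = β-nontorsion 0 (c , trans (L.*-identityʳ β) β≈c)

        -- Here `d` is `s / t²`.
        β*β≈ : β * β ≈ β + ι (s K.* (t′ K.* t′))
        β*β≈ = begin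
          (ι t′ * α) * (ι t′ * α)
            ≈⟨ solve 2 (λ u a → (u :* a) :* (u :* a) := (u :* u) :* (a :* a)) refl (ι t′) α ⟩
          (ι t′ * ι t′) * (α * α)
            ≈⟨ *-congˡ α*α≈ ⟩
          (ι t′ * ι t′) * (ι s + ι t * α)
            ≈⟨ solve 4 (λ u s t a → (u :* u) :* (s :+ t :* a) := (t :* u) :* (u :* a) :+ s :* (u :* u)) refl (ι t′) (ι s) (ι t) α ⟩
          (ι t * ι t′) * (ι t′ * α) + ι s * (ι t′ * ι t′)
            ≈⟨ +-cong (trans (*-congʳ ιtt′≈1) (L.*-identityˡ _)) (sym (trans (ι-* s _) (*-congˡ (ι-* t′ t′)))) ⟩
          β + ι (s K.* (t′ K.* t′)) ∎

        coordinates : ∀ y → Coordinates β y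
        coordinates y = convert (spans y)
          where
          convert : Coordinates α y → Coordinates β y
          convert (a , b , y≈) = a , b K.* t , (begin
            y                            ≈⟨ y≈ ⟩
            ι a + ι b * α                ≈⟨ +-congˡ (*-congˡ tβ≈α) ⟨
            ι a + ι b * (ι t * β)        ≈⟨ +-congˡ (L.*-assoc _ _ _) ⟨
            ι a + (ι b * ι t) * β        ≈⟨ +-congˡ (*-congʳ (ι-* b t)) ⟨
            ι a + ι (b K.* t) * β        ∎)

  -- The empty set is maximal: a member `u` of a larger independent set would have a power that is
  -- trivial modulo `Kˣ`, a relation with nonzero coefficient.
  torsion⇒rank-zero : (∀ u → ∃[ n ] Rational (proj₁ u ^ suc n)) → HasRationalRank A 0
  torsion⇒rank-zero torsion = ∅ , maximal-∅ , record
    { to        = λ ()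
    ; cong      = λ { {()} }
    ; bijective = (λ { {()} }) , λ ()
    }
    where
    ∅ : Pred A.Carrier _
    ∅ _ = Lift _ ⊥

    maximal-∅ : IsMaximalIndependent A ∅
    maximal-∅ = record
      { respects    = λ _ ()
      ; independent = λ _ _ x∈∅ _ _ _ i → ⊥-elim (lower (x∈∅ i))
      ; maximal     = λ T _ T-independent _ {u} u∈T → ⊥-elim (dependent T T-independent u u∈T (torsion u))
      }
      where
      dependent : ∀ T → LinearlyIndependent A T → ∀ u → T u → ¬ (∃[ n ] Rational (proj₁ u ^ suc n))
      dependent T T-independent u u∈T (n , c , u^≈c) =
        absurd (T-independent 1 (λ _ → u) (λ _ → u∈T) (λ { {Fin.zero} {Fin.zero} _ → ≡.refl })
                 (λ _ → + suc n) relation Fin.zero)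
        where
        absurd : ¬ (+ suc n ≡ + 0)
        absurd ()

        c≉0 : c ≉0
        c≉0 c≈0 = L.^-≉0 (suc n) u≉0 (trans u^≈c (trans (ι-cong c≈0) ι-0))
          where
          u≉0 : proj₁ u L.≉0
          u≉0 u≈0 = IsField.1≉0 isFieldL (trans (sym (proj₂ (proj₂ (proj₂ u)))) (trans (*-congʳ u≈0) (L.zeroˡ _)))

        relation : ((suc n ×ℕ u) A.∙ A.ε) A.≈ A.ε
        relation = (c , IsField.invertible isFieldK c c≉0) ,
          *-congʳ (trans (L.reflexive (proj₁-× (suc n) u)) u^≈c)

  -- `α` ranges over all of `L` and not only over units; an `α` without rational powers is nonzero
  -- anyway, as the powers of zero are rational.
  rank-zero-or-infinite : HasDegree K L ι 2 → HasRationalRank A 0 ⊎ HasInfiniteRationalRank A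
  rank-zero-or-infinite deg with em _ {∃[ α ] ∀ n → ¬ Rational (α ^ suc n)}
  ... | yes (_ , α-nontorsion) = inj₂ (nontorsion⇒infinite-rank deg α-nontorsion)
  ... | no ¬nontorsion = inj₁ (torsion⇒rank-zero λ u → decidable-stable (em _) λ u-nontorsion →
          ¬nontorsion (proj₁ u , λ n r → u-nontorsion (n , r)))

theorem3p3 :
    (∀ ℓ → ExcludedMiddle ℓ) →
    ∀ {k ℓk l ℓl} (K : CommutativeRing k ℓk) (L : CommutativeRing l ℓl) →
    IsField K → IsField L →
    (ι : CommutativeRing.Carrier K → CommutativeRing.Carrier L)
    (ι-hom : IsRingHomomorphism (CommutativeRing.rawRing K) (CommutativeRing.rawRing L) ι) →
    HasDegree K L ι 2 →
    HasRationalRank (unitsQuotient K L ι-hom) 0 ⊎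
    HasInfiniteRationalRank (unitsQuotient K L ι-hom)
theorem3p3 em K L isFieldK isFieldL ι ι-hom = QuadraticExtension.rank-zero-or-infinite em K L isFieldK isFieldL ι-hom
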